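{- Let $\lambda\in\mathbb{R}$, let $r,k\ge1$ be integers and let $z\in\mathbb{C}$. Then \[ \phi_{k,\lambda}^{(r,r)}(|z|^2)=e^{ -|z|^2}\sum_{n=1}^{\infty}\frac{(|z|^2)^n}{n!}\big((n)_r\big)_{k,\lambda}. \] In particular, when $|z|=1$, \[ \phi_{k,\lambda}^{(r,r)}=\frac{1}{e}\sum_{n=1}^{\infty}\frac{1}{n!}\big((n)_r\big)_{k,\lambda}. \]
   Context: Notation: $(x)_0=1$, $(x)_m=x(x-1)\cdots(x-m+1)$; $(y)_{0,\lambda}=1$, $(y)_{k,\lambda}=y(y-\lambda)\cdots(y-(k-1)\lambda)$. Let $D=\frac{d}{dx}$ and let $x$ also denote multiplication by $x$. The numbers $S_\lambda^{(r,r)}(k,j)$, $0\le j\le kr$, are defined by the operator identity $\prod_{i=0}^{k-1}\big(x^{r}D^{r}-i\lambda\big)=\sum_{j=0}^{kr}S_\lambda^{(r,r)}(k,j)\,x^{j}D^{j}$ (equivalently, the boson normal ordering $\prod_{i=0}^{k-1}\big((a^{\dagger})^{r}a^{r}-i\lambda\big)=\sum_{j=0}^{kr}S_\lambda^{(r,r)}(k,j)(a^{\dagger})^{j}a^{j}$ with $[a,a^{\dagger}]=1$), and $\phi_{k,\lambda}^{(r,r)}(x)=\sum_{j=0}^{kr}S_\lambda^{(r,r)}(k,j)x^j$, $\phi_{k,\lambda}^{(r,r)}=\phi_{k,\lambda}^{(r,r)}(1)$. -}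

module Defs where

open import Algebra.Bundles using (CommutativeRing)
open import Data.Fin.Base using (toℕ)
open import Data.Integer.Base as ℤ using (+_; -[1+_])
import Data.Integer.Properties as ℤ
open import Data.List.Base using (List; []; _∷_; map)
open import Data.Nat.Base as ℕ using (ℕ; zero; suc; _!)
import Data.Nat.Properties as ℕ
open import Data.Product.Base using (∃; _×_; _,_; proj₁; proj₂)
open import Data.Rational.Base as ℚ using (ℚ; 0ℚ; 1ℚ; ½)
import Data.Rational.Properties as ℚ
open import Data.Rational.Solver using (module +-*-Solver)
import Data.Rational.Unnormalised.Base as ℚᵘ
import Data.Rational.Unnormalised.Properties as ℚᵘ
open import Data.Sum.Base using (inj₁; inj₂)
open import Data.Vec.Functional using (Vector; foldr)
open import Function.Base using (id; _∘_)
import Function.Endo.Propositional as Endo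
open import Level using (0ℓ)
open import Relation.Binary.PropositionalEquality
  using (_≡_; refl; sym; trans; cong; cong₂; subst; subst₂)

open +-*-Solver using (solve; _:=_; _:+_; _:*_; _:-_; :-_; con)

------------------------------------------------------------------------
-- Real numbers: Cauchy sequences of rationals, under the equivalence _≈_

Eventually : (ℕ → Set) → Set
Eventually P = ∃ λ N → ∀ n → N ℕ.≤ n → P n

IsCauchy : (ℕ → ℚ) → Set
IsCauchy x = ∀ ε → 0ℚ ℚ.< ε →
  ∃ λ N → ∀ m n → N ℕ.≤ m → N ℕ.≤ n → ℚ.∣ x m ℚ.- x n ∣ ℚ.< ε

record ℝ : Set where
  no-eta-equality
  constructor mkℝ
  field
    seq    : ℕ → ℚ
    cauchy : IsCauchy seq

open ℝ public

infix 4 _≈_ _<_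

_≈_ : ℝ → ℝ → Set
x ≈ y = ∀ ε → 0ℚ ℚ.< ε → Eventually λ n → ℚ.∣ seq x n ℚ.- seq y n ∣ ℚ.< ε

_<_ : ℝ → ℝ → Set
x < y = ∃ λ δ → 0ℚ ℚ.< δ × Eventually λ n → seq x n ℚ.+ δ ℚ.≤ seq y n

------------------------------------------------------------------------
-- Estimates

module Estimates where

  both : ∀ {P Q R : ℕ → Set} → (∀ n → P n → Q n → R n) →
         Eventually P → Eventually Q → Eventually R
  both f (M , p) (N , q) = M ℕ.⊔ N , λ n le →
    f n (p n (ℕ.≤-trans (ℕ.m≤m⊔n M N) le)) (q n (ℕ.≤-trans (ℕ.m≤n⊔m M N) le))

  *-pos : ∀ {p q} → 0ℚ ℚ.< p → 0ℚ ℚ.< q → 0ℚ ℚ.< p ℚ.* q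
  *-pos {p} {q} 0<p 0<q =
    ℚ.positive⁻¹ (p ℚ.* q) {{ℚ.pos*pos⇒pos p {{ℚ.positive 0<p}} q {{ℚ.positive 0<q}}}}

  ½ε>0 : ∀ {ε} → 0ℚ ℚ.< ε → 0ℚ ℚ.< ½ ℚ.* ε
  ½ε>0 = *-pos (ℚ.positive⁻¹ ½)

  halves : ∀ ε → ½ ℚ.* ε ℚ.+ ½ ℚ.* ε ≡ ε
  halves = solve 1 (λ ε → con ½ :* ε :+ con ½ :* ε := ε) refl

  ∣p-p∣≡0 : ∀ p → ℚ.∣ p ℚ.- p ∣ ≡ 0ℚ
  ∣p-p∣≡0 p = cong ℚ.∣_∣ (ℚ.+-inverseʳ p)

  dist-sym : ∀ p q → ℚ.∣ p ℚ.- q ∣ ≡ ℚ.∣ q ℚ.- p ∣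
  dist-sym p q = trans (sym (ℚ.∣-p∣≡∣p∣ (p ℚ.- q)))
    (cong ℚ.∣_∣ (solve 2 (λ p q → :- (p :- q) := q :- p) refl p q))

  dist-triangle : ∀ p q r → ℚ.∣ p ℚ.- r ∣ ℚ.≤ ℚ.∣ p ℚ.- q ∣ ℚ.+ ℚ.∣ q ℚ.- r ∣
  dist-triangle p q r = subst (ℚ._≤ (ℚ.∣ p ℚ.- q ∣ ℚ.+ ℚ.∣ q ℚ.- r ∣))
    (cong ℚ.∣_∣ (solve 3 (λ p q r → (p :- q) :+ (q :- r) := p :- r) refl p q r))
    (ℚ.∣p+q∣≤∣p∣+∣q∣ (p ℚ.- q) (q ℚ.- r))

  halves-< : ∀ {p a b} ε → p ℚ.≤ a ℚ.+ b → a ℚ.< ½ ℚ.* ε → b ℚ.< ½ ℚ.* ε → p ℚ.< ε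
  halves-< {p} ε le a< b< =
    subst (p ℚ.<_) (halves ε) (ℚ.≤-<-trans le (ℚ.+-mono-< a< b<))

  dist-+ : ∀ a b c d →
    ℚ.∣ (a ℚ.+ b) ℚ.- (c ℚ.+ d) ∣ ℚ.≤ ℚ.∣ a ℚ.- c ∣ ℚ.+ ℚ.∣ b ℚ.- d ∣
  dist-+ a b c d = subst (ℚ._≤ (ℚ.∣ a ℚ.- c ∣ ℚ.+ ℚ.∣ b ℚ.- d ∣))
    (cong ℚ.∣_∣ (solve 4 (λ a b c d →
      (a :- c) :+ (b :- d) := (a :+ b) :- (c :+ d)) refl a b c d))
    (ℚ.∣p+q∣≤∣p∣+∣q∣ (a ℚ.- c) (b ℚ.- d))

  dist-neg : ∀ a b → ℚ.∣ ℚ.- a ℚ.- (ℚ.- b) ∣ ≡ ℚ.∣ a ℚ.- b ∣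
  dist-neg a b = trans
    (cong ℚ.∣_∣ (solve 2 (λ a b → :- a :- (:- b) := :- (a :- b)) refl a b))
    (ℚ.∣-p∣≡∣p∣ (a ℚ.- b))

  abs-diff : ∀ a b → ℚ.∣ a ∣ ℚ.- ℚ.∣ b ∣ ℚ.≤ ℚ.∣ a ℚ.- b ∣
  abs-diff a b = subst (ℚ.∣ a ∣ ℚ.- ℚ.∣ b ∣ ℚ.≤_)
    (solve 2 (λ p q → (p :+ q) :- q := p) refl (ℚ.∣ a ℚ.- b ∣) (ℚ.∣ b ∣))
    (ℚ.+-monoˡ-≤ (ℚ.- ℚ.∣ b ∣)
      (subst (λ t → ℚ.∣ t ∣ ℚ.≤ ℚ.∣ a ℚ.- b ∣ ℚ.+ ℚ.∣ b ∣)
        (solve 2 (λ a b → (a :- b) :+ b := a) refl a b)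
        (ℚ.∣p+q∣≤∣p∣+∣q∣ (a ℚ.- b) b)))

  dist-abs : ∀ a b → ℚ.∣ ℚ.∣ a ∣ ℚ.- ℚ.∣ b ∣ ∣ ℚ.≤ ℚ.∣ a ℚ.- b ∣
  dist-abs a b with ℚ.∣p∣≡p∨∣p∣≡-p (ℚ.∣ a ∣ ℚ.- ℚ.∣ b ∣)
  ... | inj₁ eq = subst (ℚ._≤ ℚ.∣ a ℚ.- b ∣) (sym eq) (abs-diff a b)
  ... | inj₂ eq = subst₂ ℚ._≤_ (sym (trans eq swap)) (dist-sym b a) (abs-diff b a)
    where
    swap : ℚ.- (ℚ.∣ a ∣ ℚ.- ℚ.∣ b ∣) ≡ ℚ.∣ b ∣ ℚ.- ℚ.∣ a ∣
    swap = solve 2 (λ a b → :- (a :- b) := b :- a) refl (ℚ.∣ a ∣) (ℚ.∣ b ∣)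

  *-mono-≤ : ∀ {a b c d} → 0ℚ ℚ.≤ b → 0ℚ ℚ.≤ c → a ℚ.≤ b → c ℚ.≤ d →
             a ℚ.* c ℚ.≤ b ℚ.* d
  *-mono-≤ {b = b} {c} 0≤b 0≤c a≤b c≤d = ℚ.≤-trans
    (ℚ.*-monoʳ-≤-nonNeg c {{ℚ.nonNegative 0≤c}} a≤b)
    (ℚ.*-monoˡ-≤-nonNeg b {{ℚ.nonNegative 0≤b}} c≤d)

  dist-* : ∀ a b c d {B C δ} → 0ℚ ℚ.< B → 0ℚ ℚ.< C →
    ℚ.∣ a ∣ ℚ.≤ B → ℚ.∣ d ∣ ℚ.≤ C →
    ℚ.∣ a ℚ.- c ∣ ℚ.< δ → ℚ.∣ b ℚ.- d ∣ ℚ.< δ →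
    ℚ.∣ a ℚ.* b ℚ.- c ℚ.* d ∣ ℚ.< (B ℚ.+ C) ℚ.* δ
  dist-* a b c d {B} {C} {δ} 0<B 0<C a≤B d≤C ac<δ bd<δ = begin-strict
    ℚ.∣ a ℚ.* b ℚ.- c ℚ.* d ∣
      ≡⟨ cong ℚ.∣_∣ (solve 4 (λ a b c d →
           a :* b :- c :* d := a :* (b :- d) :+ d :* (a :- c)) refl a b c d) ⟩
    ℚ.∣ a ℚ.* (b ℚ.- d) ℚ.+ d ℚ.* (a ℚ.- c) ∣
      ≤⟨ ℚ.∣p+q∣≤∣p∣+∣q∣ (a ℚ.* (b ℚ.- d)) (d ℚ.* (a ℚ.- c)) ⟩
    ℚ.∣ a ℚ.* (b ℚ.- d) ∣ ℚ.+ ℚ.∣ d ℚ.* (a ℚ.- c) ∣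
      ≡⟨ cong₂ ℚ._+_ (ℚ.∣p*q∣≡∣p∣*∣q∣ a (b ℚ.- d)) (ℚ.∣p*q∣≡∣p∣*∣q∣ d (a ℚ.- c)) ⟩
    ℚ.∣ a ∣ ℚ.* ℚ.∣ b ℚ.- d ∣ ℚ.+ ℚ.∣ d ∣ ℚ.* ℚ.∣ a ℚ.- c ∣
      <⟨ ℚ.+-mono-< (part a (b ℚ.- d) 0<B a≤B bd<δ) (part d (a ℚ.- c) 0<C d≤C ac<δ) ⟩
    B ℚ.* δ ℚ.+ C ℚ.* δ
      ≡⟨ sym (ℚ.*-distribʳ-+ δ B C) ⟩
    (B ℚ.+ C) ℚ.* δ ∎
    where
    open ℚ.≤-Reasoning
    part : ∀ p q {B} → 0ℚ ℚ.< B → ℚ.∣ p ∣ ℚ.≤ B → ℚ.∣ q ∣ ℚ.< δ →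
           ℚ.∣ p ∣ ℚ.* ℚ.∣ q ∣ ℚ.< B ℚ.* δ
    part p q {B} 0<B p≤B q<δ = ℚ.≤-<-trans
      (ℚ.*-monoʳ-≤-nonNeg ℚ.∣ q ∣ {{ℚ.nonNegative (ℚ.0≤∣p∣ q)}} p≤B)
      (ℚ.*-monoʳ-<-pos B {{ℚ.positive 0<B}} q<δ)

  quotient : ∀ {p ε} → 0ℚ ℚ.< p → 0ℚ ℚ.< ε → ∃ λ δ → 0ℚ ℚ.< δ × p ℚ.* δ ≡ ε
  quotient {p} {ε} 0<p 0<ε = p⁻¹ ℚ.* ε , *-pos 0<p⁻¹ 0<ε ,
    trans (sym (ℚ.*-assoc p p⁻¹ ε))
      (trans (cong (ℚ._* ε) (ℚ.*-inverseʳ p {{p≢0}})) (ℚ.*-identityˡ ε))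
    where
    p≢0 = ℚ.>-nonZero 0<p
    p⁻¹ = ℚ.1/_ p {{p≢0}}
    0<p⁻¹ : 0ℚ ℚ.< p⁻¹
    0<p⁻¹ = ℚ.positive⁻¹ p⁻¹ {{ℚ.1/pos⇒pos p {{ℚ.positive 0<p}}}}

  +-pos : ∀ {p q} → 0ℚ ℚ.< p → 0ℚ ℚ.< q → 0ℚ ℚ.< p ℚ.+ q
  +-pos = ℚ.+-mono-<

  prefix : (ℕ → ℚ) → ℕ → ℚ
  prefix x zero    = ℚ.∣ x 0 ∣
  prefix x (suc n) = prefix x n ℚ.+ ℚ.∣ x (suc n) ∣

  p≤p+∣q∣ : ∀ p q → p ℚ.≤ p ℚ.+ ℚ.∣ q ∣
  p≤p+∣q∣ p q = subst (ℚ._≤ p ℚ.+ ℚ.∣ q ∣) (ℚ.+-identityʳ p)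
    (ℚ.+-monoʳ-≤ p (ℚ.0≤∣p∣ q))

  0≤prefix : ∀ x n → 0ℚ ℚ.≤ prefix x n
  0≤prefix x zero    = ℚ.0≤∣p∣ (x 0)
  0≤prefix x (suc n) = ℚ.≤-trans (0≤prefix x n) (p≤p+∣q∣ _ (x (suc n)))

  last≤prefix : ∀ x n → ℚ.∣ x n ∣ ℚ.≤ prefix x n
  last≤prefix x zero    = ℚ.≤-refl
  last≤prefix x (suc n) = subst (ℚ._≤ prefix x (suc n)) (ℚ.+-identityˡ _)
    (ℚ.+-monoˡ-≤ ℚ.∣ x (suc n) ∣ (0≤prefix x n))

  term≤prefix : ∀ x {k n} → k ℕ.≤′ n → ℚ.∣ x k ∣ ℚ.≤ prefix x n
  term≤prefix x {k} ℕ.≤′-refl           = last≤prefix x k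
  term≤prefix x {n = suc n} (ℕ.≤′-step le) =
    ℚ.≤-trans (term≤prefix x le) (p≤p+∣q∣ _ (x (suc n)))

  bounded : ∀ x → ∃ λ B → 0ℚ ℚ.< B × ∀ k → ℚ.∣ seq x k ∣ ℚ.≤ B
  bounded r with cauchy r 1ℚ (ℚ.positive⁻¹ 1ℚ)
  ... | N , close = B , ℚ.+-mono-≤-< (0≤prefix x N) (ℚ.positive⁻¹ 1ℚ) , bound
    where
    x = seq r
    B = prefix x N ℚ.+ 1ℚ
    bound : ∀ k → ℚ.∣ x k ∣ ℚ.≤ B
    bound k with ℕ.≤-total k N
    ... | inj₁ k≤N = ℚ.≤-trans (term≤prefix x (ℕ.≤⇒≤′ k≤N)) (p≤p+∣q∣ (prefix x N) 1ℚ)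
    ... | inj₂ N≤k = subst (ℚ._≤ B)
      (cong ℚ.∣_∣ (solve 2 (λ p q → p :+ (q :- p) := q) refl (x N) (x k)))
      (ℚ.≤-trans (ℚ.∣p+q∣≤∣p∣+∣q∣ (x N) (x k ℚ.- x N))
        (ℚ.+-mono-≤ (last≤prefix x N) (ℚ.<⇒≤ (close k N N≤k ℕ.≤-refl))))

  pointwise : ∀ x y → (∀ n → seq x n ≡ seq y n) → x ≈ y
  pointwise x y eq ε 0<ε = 0 , λ n _ → subst (ℚ._< ε)
    (sym (trans (cong (λ t → ℚ.∣ t ℚ.- seq y n ∣) (eq n)) (∣p-p∣≡0 (seq y n)))) 0<ε

open Estimates

------------------------------------------------------------------------
-- The ring of real numbers; all operations are pointwise

private
  opaque

    const-cauchy : ∀ q → IsCauchy (λ _ → q)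
    const-cauchy q ε 0<ε = 0 , λ _ _ _ _ → subst (ℚ._< ε) (sym (∣p-p∣≡0 q)) 0<ε

    abs-cauchy : ∀ x → IsCauchy (λ n → ℚ.∣ seq x n ∣)
    abs-cauchy x ε 0<ε = let N , close = cauchy x ε 0<ε in
      N , λ m n m≥ n≥ → ℚ.≤-<-trans (dist-abs (seq x m) (seq x n)) (close m n m≥ n≥)

    add-cauchy : ∀ x y → IsCauchy (λ n → seq x n ℚ.+ seq y n)
    add-cauchy x y ε 0<ε =
      let M , closeˣ = cauchy x _ (½ε>0 0<ε)
          N , closeʸ = cauchy y _ (½ε>0 0<ε)
          l = λ {n} → ℕ.≤-trans {k = n} (ℕ.m≤m⊔n M N)
          r = λ {n} → ℕ.≤-trans {k = n} (ℕ.m≤n⊔m M N)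
      in M ℕ.⊔ N , λ m n m≥ n≥ →
           halves-< ε (dist-+ (seq x m) (seq y m) (seq x n) (seq y n))
             (closeˣ m n (l m≥) (l n≥)) (closeʸ m n (r m≥) (r n≥))

    neg-cauchy : ∀ x → IsCauchy (λ n → ℚ.- seq x n)
    neg-cauchy x ε 0<ε = let N , close = cauchy x ε 0<ε in
      N , λ m n m≥ n≥ →
        subst (ℚ._< ε) (sym (dist-neg (seq x m) (seq x n))) (close m n m≥ n≥)

    mul-cauchy : ∀ x y → IsCauchy (λ n → seq x n ℚ.* seq y n)
    mul-cauchy x y ε 0<ε =
      let B , 0<B , x≤B = bounded x
          C , 0<C , y≤C = bounded y
          δ , 0<δ , eq = quotient (+-pos 0<B 0<C) 0<ε
          M , closeˣ = cauchy x δ 0<δ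
          N , closeʸ = cauchy y δ 0<δ
          l = λ {n} → ℕ.≤-trans {k = n} (ℕ.m≤m⊔n M N)
          r = λ {n} → ℕ.≤-trans {k = n} (ℕ.m≤n⊔m M N)
      in M ℕ.⊔ N , λ m n m≥ n≥ → subst (_ ℚ.<_) eq
           (dist-* (seq x m) (seq y m) (seq x n) (seq y n) 0<B 0<C (x≤B m) (y≤C n)
             (closeˣ m n (l m≥) (l n≥)) (closeʸ m n (r m≥) (r n≥)))

fromℚ : ℚ → ℝ
fromℚ q = mkℝ (λ _ → q) (const-cauchy q)

∣_∣ : ℝ → ℝ
∣ x ∣ = mkℝ (λ n → ℚ.∣ seq x n ∣) (abs-cauchy x)

private

  add : ℝ → ℝ → ℝ
  add x y = mkℝ (λ n → seq x n ℚ.+ seq y n) (add-cauchy x y)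

  neg : ℝ → ℝ
  neg x = mkℝ (λ n → ℚ.- seq x n) (neg-cauchy x)

  mul : ℝ → ℝ → ℝ
  mul x y = mkℝ (λ n → seq x n ℚ.* seq y n) (mul-cauchy x y)

  ≈-refl : ∀ {x} → x ≈ x
  ≈-refl {x} = pointwise x x (λ _ → refl)

  ≈-sym : ∀ {x y} → x ≈ y → y ≈ x
  ≈-sym {x} {y} x≈y ε 0<ε = let N , close = x≈y ε 0<ε in
    N , λ n n≥ → subst (ℚ._< ε) (dist-sym (seq x n) (seq y n)) (close n n≥)

  ≈-trans : ∀ {x y z} → x ≈ y → y ≈ z → x ≈ z
  ≈-trans {x} {y} {z} x≈y y≈z ε 0<ε = both
    (λ n → halves-< ε (dist-triangle (seq x n) (seq y n) (seq z n)))
    (x≈y _ (½ε>0 0<ε)) (y≈z _ (½ε>0 0<ε))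

  add-cong : ∀ {x y u v} → x ≈ y → u ≈ v → add x u ≈ add y v
  add-cong {x} {y} {u} {v} x≈y u≈v ε 0<ε = both
    (λ n → halves-< ε (dist-+ (seq x n) (seq u n) (seq y n) (seq v n)))
    (x≈y _ (½ε>0 0<ε)) (u≈v _ (½ε>0 0<ε))

  neg-cong : ∀ {x y} → x ≈ y → neg x ≈ neg y
  neg-cong {x} {y} x≈y ε 0<ε = let N , close = x≈y ε 0<ε in
    N , λ n n≥ → subst (ℚ._< ε) (sym (dist-neg (seq x n) (seq y n))) (close n n≥)

  mul-cong : ∀ {x y u v} → x ≈ y → u ≈ v → mul x u ≈ mul y v
  mul-cong {x} {y} {u} {v} x≈y u≈v ε 0<ε =
    let B , 0<B , x≤B = bounded x
        C , 0<C , v≤C = bounded v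
        δ , 0<δ , eq = quotient (+-pos 0<B 0<C) 0<ε
    in both
      (λ n xy uv → subst (_ ℚ.<_) eq
        (dist-* (seq x n) (seq u n) (seq y n) (seq v n) 0<B 0<C (x≤B n) (v≤C n) xy uv))
      (x≈y δ 0<δ) (u≈v δ 0<δ)

ℝ-commutativeRing : CommutativeRing 0ℓ 0ℓ
ℝ-commutativeRing = record
  { Carrier = ℝ
  ; _≈_ = _≈_
  ; _+_ = add
  ; _*_ = mul
  ; -_  = neg
  ; 0#  = fromℚ 0ℚ
  ; 1#  = fromℚ 1ℚ
  ; isCommutativeRing = record
    { isRing = record
      { +-isAbelianGroup = record
        { isGroup = record
          { isMonoid = record
            { isSemigroup = record
              { isMagma = record
                { isEquivalence = record
                  { refl  = λ {x} → ≈-refl {x}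
                  ; sym   = λ {x} {y} → ≈-sym {x} {y}
                  ; trans = λ {x} {y} {z} → ≈-trans {x} {y} {z}
                  }
                ; ∙-cong = λ {x} {y} {u} {v} → add-cong {x} {y} {u} {v}
                }
              ; assoc = λ x y z → pointwise (add (add x y) z) (add x (add y z))
                  λ n → ℚ.+-assoc (seq x n) (seq y n) (seq z n)
              }
            ; identity =
                (λ x → pointwise (add (fromℚ 0ℚ) x) x λ n → ℚ.+-identityˡ (seq x n)) ,
                (λ x → pointwise (add x (fromℚ 0ℚ)) x λ n → ℚ.+-identityʳ (seq x n))
            }
          ; inverse =
              (λ x → pointwise (add (neg x) x) (fromℚ 0ℚ) λ n → ℚ.+-inverseˡ (seq x n)) ,
              (λ x → pointwise (add x (neg x)) (fromℚ 0ℚ) λ n → ℚ.+-inverseʳ (seq x n))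
          ; ⁻¹-cong = λ {x} {y} → neg-cong {x} {y}
          }
        ; comm = λ x y → pointwise (add x y) (add y x) λ n → ℚ.+-comm (seq x n) (seq y n)
        }
      ; *-cong = λ {x} {y} {u} {v} → mul-cong {x} {y} {u} {v}
      ; *-assoc = λ x y z → pointwise (mul (mul x y) z) (mul x (mul y z))
          λ n → ℚ.*-assoc (seq x n) (seq y n) (seq z n)
      ; *-identity =
          (λ x → pointwise (mul (fromℚ 1ℚ) x) x λ n → ℚ.*-identityˡ (seq x n)) ,
          (λ x → pointwise (mul x (fromℚ 1ℚ)) x λ n → ℚ.*-identityʳ (seq x n))
      ; distrib =
          (λ x y z → pointwise (mul x (add y z)) (add (mul x y) (mul x z))
            λ n → ℚ.*-distribˡ-+ (seq x n) (seq y n) (seq z n)) ,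
          (λ x y z → pointwise (mul (add y z) x) (add (mul y x) (mul z x))
            λ n → ℚ.*-distribʳ-+ (seq x n) (seq y n) (seq z n))
      }
    ; *-comm = λ x y → pointwise (mul x y) (mul y x) λ n → ℚ.*-comm (seq x n) (seq y n)
    }
  }

open CommutativeRing ℝ-commutativeRing public
  using (_+_; _*_; -_; _-_; 0#; 1#)

open import Algebra.Properties.Semiring.Exp
  (CommutativeRing.semiring ℝ-commutativeRing) public using (_^_)
open import Algebra.Properties.Semiring.Sum
  (CommutativeRing.semiring ℝ-commutativeRing) public using (sum; sum-syntax; sum⁺-syntax)

fromℕ : ℕ → ℝ
fromℕ n = fromℚ (+ n ℚ./ 1)

1/_! : ℕ → ℝ
1/ n ! = fromℚ ((+ 1 ℚ./ n !) {{n ℕ.!≢0}})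

------------------------------------------------------------------------
-- Limits and series

infix 4 _⟶_

_⟶_ : (ℕ → ℝ) → ℝ → Set
s ⟶ L = ∀ ε → 0# < ε → Eventually λ n → ∣ s n - L ∣ < ε

-- HasSum f σ means ∑_{n ≥ 0} f n = σ, and HasSum₁ f σ means ∑_{n ≥ 1} f n = σ.
HasSum HasSum₁ : (ℕ → ℝ) → ℝ → Set
HasSum  f σ = (λ N → ∑[ n < N ] f (toℕ n)) ⟶ σ
HasSum₁ f σ = HasSum (f ∘ suc) σ

module SeriesLemmas where

  sum-last : ∀ n (f : ℕ → ℝ) k →
    seq (∑[ i < suc n ] f (toℕ i)) k ≡ seq (∑[ i < n ] f (toℕ i)) k ℚ.+ seq (f n) k
  sum-last zero    f k = ℚ.+-comm (seq (f 0) k) 0ℚ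
  sum-last (suc n) f k = trans
    (cong (seq (f 0) k ℚ.+_) (sum-last n (f ∘ suc) k))
    (sym (ℚ.+-assoc (seq (f 0) k) (seq (∑[ i < n ] f (suc (toℕ i))) k) (seq (f (suc n)) k)))

  ½ε<ε : ∀ {ε} → 0ℚ ℚ.< ε → ½ ℚ.* ε ℚ.< ε
  ½ε<ε {ε} 0<ε = subst₂ ℚ._<_ (ℚ.+-identityʳ _) (halves ε)
    (ℚ.+-monoʳ-< (½ ℚ.* ε) (½ε>0 0<ε))

  uniform-limit : (s : ℕ → ℝ) →
    (∀ ε → 0ℚ ℚ.< ε → ∃ λ N → ∀ n → N ℕ.≤ n → ∀ k →
      ℚ.∣ seq (s n) k ℚ.- seq (s N) k ∣ ℚ.< ε) →
    ∃ λ L → s ⟶ L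
  uniform-limit s uniform = mkℝ d cauchy-d , converges
    where
    d : ℕ → ℚ
    d k = seq (s k) k

    cauchy-d : IsCauchy d
    cauchy-d ε 0<ε =
      let ε/2 = ½ ℚ.* ε ; 0<ε/2 = ½ε>0 0<ε ; 0<ε/4 = ½ε>0 0<ε/2
          M , u = uniform _ 0<ε/4
          N , c = cauchy (s M) _ 0<ε/4
          l = λ {n} → ℕ.≤-trans {k = n} (ℕ.m≤m⊔n M N)
          r = λ {n} → ℕ.≤-trans {k = n} (ℕ.m≤n⊔m M N)
      in M ℕ.⊔ N , λ m n m≥ n≥ →
        halves-< ε (dist-triangle (d m) (seq (s M) m) (d n))
          (ℚ.<-trans (u m (l m≥) m) (½ε<ε 0<ε/2))
          (halves-< ε/2 (dist-triangle (seq (s M) m) (seq (s M) n) (d n))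
            (c m n (r m≥) (r n≥))
            (subst (ℚ._< _) (dist-sym (d n) (seq (s M) n)) (u n (l n≥) n)))

    converges : s ⟶ mkℝ d cauchy-d
    converges ε (δ , 0<δ , K , δ≤ε) =
      let δ/2 = ½ ℚ.* δ ; 0<δ/2 = ½ε>0 0<δ
          M , u = uniform _ (½ε>0 0<δ/2)
      in M , λ n n≥ → δ/2 , 0<δ/2 , M ℕ.⊔ K , λ k k≥ → ℚ.≤-trans
        (ℚ.+-monoˡ-≤ δ/2 (ℚ.<⇒≤
          (halves-< δ/2 (dist-triangle (seq (s n) k) (seq (s M) k) (d k))
            (u n n≥ k)
            (subst (ℚ._< _) (dist-sym (d k) (seq (s M) k))
              (u k (ℕ.≤-trans (ℕ.m≤m⊔n M K) k≥) k)))))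
        (subst (ℚ._≤ seq ε k) (trans (ℚ.+-identityˡ δ) (sym (halves δ)))
          (δ≤ε k (ℕ.≤-trans (ℕ.m≤n⊔m M K) k≥)))

open SeriesLemmas

------------------------------------------------------------------------
-- The exponential function

expTerm : ℝ → ℕ → ℝ
expTerm x n = x ^ n * 1/ n !

module ExpLemmas where

  1/1+_ : ℕ → ℚ
  1/1+ n = + 1 ℚ./ suc n

  toℚᵘ-/ : ∀ i n → ℚ.toℚᵘ (i ℚ./ suc n) ℚᵘ.≃ ℚᵘ.mkℚᵘ i n
  toℚᵘ-/ i n = ℚ.toℚᵘ-fromℚᵘ (ℚᵘ.mkℚᵘ i n)

  1/-* : ∀ a b .{{_ : ℕ.NonZero a}} .{{_ : ℕ.NonZero b}} .{{_ : ℕ.NonZero (a ℕ.* b)}} →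
    + 1 ℚ./ (a ℕ.* b) ≡ (+ 1 ℚ./ a) ℚ.* (+ 1 ℚ./ b)
  1/-* (suc a) (suc b) = ℚ.toℚᵘ-injective (ℚᵘ.≃-trans
    (toℚᵘ-/ (+ 1) (b ℕ.+ a ℕ.* suc b))
    (ℚᵘ.≃-sym (ℚᵘ.≃-trans
      (ℚ.toℚᵘ-homo-* (+ 1 ℚ./ suc a) (+ 1 ℚ./ suc b))
      (ℚᵘ.*-cong (toℚᵘ-/ (+ 1) a) (toℚᵘ-/ (+ 1) b)))))

  1/suc! : ∀ n k → seq (1/ suc n !) k ≡ seq (1/ n !) k ℚ.* (1/1+ n)
  1/suc! n k = trans
    (1/-* (suc n) (n !) {{_}} {{n ℕ.!≢0}} {{suc n ℕ.!≢0}})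
    (ℚ.*-comm (1/1+ n) (seq (1/ n !) k))

  0<1/1+n : ∀ n → 0ℚ ℚ.< 1/1+ n
  0<1/1+n n = ℚ.positive⁻¹ (1/1+ n) {{ℚ.normalize-pos 1 (suc n)}}

  m/1+n≤1 : ∀ {m n} → m ℕ.≤ n → (+ m ℚ./ 1) ℚ.* (1/1+ n) ℚ.≤ 1ℚ
  m/1+n≤1 {m} {n} m≤n = ℚ.toℚᵘ-cancel-≤ (ℚᵘ.≤-respˡ-≃
    (ℚᵘ.≃-sym (ℚᵘ.≃-trans (ℚ.toℚᵘ-homo-* (+ m ℚ./ 1) (1/1+ n))
      (ℚᵘ.*-cong (toℚᵘ-/ (+ m) 0) (toℚᵘ-/ (+ 1) n))))
    (ℚᵘ.*≤* (subst₂ ℤ._≤_ (sym (trans (ℤ.*-identityʳ _) (ℤ.*-identityʳ (+ m))))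
      (sym (trans (ℤ.*-identityˡ _) (cong +_ (ℕ.+-identityʳ (suc n)))))
      (ℤ.+≤+ (ℕ.≤-trans m≤n (ℕ.n≤1+n n))))))

  archimedean : ∀ p → ∃ λ n → p ℚ.≤ + n ℚ./ 1
  archimedean p@(ℚ.mkℚ i d _) = ℤ.∣ i ∣ , ℚ.toℚᵘ-cancel-≤ (ℚᵘ.≤-respʳ-≃
    (ℚᵘ.≃-sym (toℚᵘ-/ (+ ℤ.∣ i ∣) 0))
    (ℚᵘ.*≤* (subst (ℤ._≤ + ℤ.∣ i ∣ ℤ.* + suc d) (sym (ℤ.*-identityʳ i))
      (ℤ.≤-trans (i≤∣i∣ i)
        (subst (+ ℤ.∣ i ∣ ℤ.≤_) (ℤ.pos-* ℤ.∣ i ∣ (suc d))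
          (ℤ.+≤+ (ℕ.m≤m*n ℤ.∣ i ∣ (suc d))))))))
    where
    i≤∣i∣ : ∀ i → i ℤ.≤ + ℤ.∣ i ∣
    i≤∣i∣ (+ n)    = ℤ.≤-refl
    i≤∣i∣ -[1+ n ] = ℤ.-≤+

  1/1+n-small : ∀ δ → 0ℚ ℚ.< δ → Eventually λ n → 1/1+ n ℚ.≤ δ
  1/1+n-small δ 0<δ =
    let γ , 0<γ , δγ≡1 = quotient 0<δ (ℚ.positive⁻¹ 1ℚ)
        N , γ≤N = archimedean γ
    in N , λ n N≤n →
      let r = 1/1+ n
          0≤r = ℚ.<⇒≤ (0<1/1+n n)
      in subst₂ ℚ._≤_
        (trans (sym (ℚ.*-assoc δ γ r)) (trans (cong (ℚ._* r) δγ≡1) (ℚ.*-identityˡ r)))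
        (ℚ.*-identityʳ δ)
        (ℚ.*-monoˡ-≤-nonNeg δ {{ℚ.nonNegative (ℚ.<⇒≤ 0<δ)}}
          (ℚ.≤-trans (ℚ.*-monoʳ-≤-nonNeg r {{ℚ.nonNegative 0≤r}} γ≤N) (m/1+n≤1 N≤n)))

  module ExpConvergence (x : ℝ) where

    B = proj₁ (bounded x)
    0<B = proj₁ (proj₂ (bounded x))
    x≤B = proj₂ (proj₂ (bounded x))
    0≤B = ℚ.<⇒≤ 0<B

    c : ℕ → ℚ
    c zero    = 1ℚ
    c (suc n) = (B ℚ.* c n) ℚ.* (1/1+ n)

    0<c : ∀ n → 0ℚ ℚ.< c n
    0<c zero    = ℚ.positive⁻¹ 1ℚ
    0<c (suc n) = *-pos (*-pos 0<B (0<c n)) (0<1/1+n n)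

    term≤c : ∀ n k → ℚ.∣ seq (expTerm x n) k ∣ ℚ.≤ c n
    term≤c zero    k = ℚ.≤-refl
    term≤c (suc n) k = subst (ℚ._≤ c (suc n)) (sym eq)
      (*-mono-≤ (ℚ.<⇒≤ (*-pos 0<B (0<c n))) (ℚ.<⇒≤ (0<1/1+n n))
        (*-mono-≤ 0≤B (ℚ.0≤∣p∣ t) (x≤B k) (term≤c n k)) ℚ.≤-refl)
      where
      t = seq (expTerm x n) k
      r = 1/1+ n
      eq : ℚ.∣ seq (expTerm x (suc n)) k ∣ ≡ (ℚ.∣ seq x k ∣ ℚ.* ℚ.∣ t ∣) ℚ.* r
      eq = trans
        (cong ℚ.∣_∣ (trans
          (cong ((seq x k ℚ.* seq (x ^ n) k) ℚ.*_) (1/suc! n k))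
          (solve 4 (λ a b c d → (a :* b) :* (c :* d) := (a :* (b :* c)) :* d) refl
            (seq x k) (seq (x ^ n) k) (seq (1/ n !) k) r)))
        (trans (ℚ.∣p*q∣≡∣p∣*∣q∣ (seq x k ℚ.* t) r)
          (cong₂ ℚ._*_ (ℚ.∣p*q∣≡∣p∣*∣q∣ (seq x k) t)
            (ℚ.0≤p⇒∣p∣≡p (ℚ.<⇒≤ (0<1/1+n n)))))

    M = proj₁ (archimedean (B ℚ.+ B))

    c-halves : ∀ n → M ℕ.≤ n → c (suc n) ℚ.+ c (suc n) ℚ.≤ c n
    c-halves n M≤n = subst₂ ℚ._≤_
      (solve 3 (λ b r c → c :* ((b :+ b) :* r) := (b :* c) :* r :+ (b :* c) :* r) refl
        B (1/1+ n) (c n))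
      (ℚ.*-identityʳ (c n))
      (ℚ.*-monoˡ-≤-nonNeg (c n) {{ℚ.nonNegative (ℚ.<⇒≤ (0<c n))}}
        (ℚ.≤-trans
          (ℚ.*-monoʳ-≤-nonNeg (1/1+ n) {{ℚ.nonNegative (ℚ.<⇒≤ (0<1/1+n n))}}
            (proj₂ (archimedean (B ℚ.+ B))))
          (m/1+n≤1 M≤n)))

    c≤c+c : ∀ n → c n ℚ.≤ c n ℚ.+ c n
    c≤c+c n = subst (ℚ._≤ c n ℚ.+ c n) (ℚ.+-identityʳ (c n))
      (ℚ.+-monoʳ-≤ (c n) (ℚ.<⇒≤ (0<c n)))

    c-decreasing : ∀ {n} → M ℕ.≤′ n → c n ℚ.≤ c M
    c-decreasing ℕ.≤′-refl = ℚ.≤-refl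
    c-decreasing {suc n} (ℕ.≤′-step M≤n) = ℚ.≤-trans (c≤c+c (suc n))
      (ℚ.≤-trans (c-halves n (ℕ.≤′⇒≤ M≤n)) (c-decreasing M≤n))

    S : ℕ → ℕ → ℚ
    S n k = seq (∑[ i < n ] expTerm x (toℕ i)) k

    tail-bound : ∀ {m n} k → M ℕ.≤ m → m ℕ.≤′ n →
      ℚ.∣ S n k ℚ.- S m k ∣ ℚ.+ (c n ℚ.+ c n) ℚ.≤ c m ℚ.+ c m
    tail-bound {m} k M≤m ℕ.≤′-refl = ℚ.≤-reflexive
      (trans (cong (ℚ._+ (c m ℚ.+ c m)) (∣p-p∣≡0 (S m k))) (ℚ.+-identityˡ _))
    tail-bound {m} {suc n} k M≤m (ℕ.≤′-step m≤n) = begin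
      ℚ.∣ S (suc n) k ℚ.- S m k ∣ ℚ.+ (c (suc n) ℚ.+ c (suc n))
        ≡⟨ cong (λ s → ℚ.∣ s ℚ.- S m k ∣ ℚ.+ (c (suc n) ℚ.+ c (suc n)))
             (sum-last n (expTerm x) k) ⟩
      ℚ.∣ (S n k ℚ.+ t) ℚ.- S m k ∣ ℚ.+ (c (suc n) ℚ.+ c (suc n))
        ≡⟨ cong (λ s → ℚ.∣ s ∣ ℚ.+ (c (suc n) ℚ.+ c (suc n)))
             (solve 3 (λ a b c → (a :+ b) :- c := (a :- c) :+ b) refl (S n k) t (S m k)) ⟩
      ℚ.∣ (S n k ℚ.- S m k) ℚ.+ t ∣ ℚ.+ (c (suc n) ℚ.+ c (suc n))
        ≤⟨ ℚ.+-mono-≤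
             (ℚ.≤-trans (ℚ.∣p+q∣≤∣p∣+∣q∣ (S n k ℚ.- S m k) t)
               (ℚ.+-monoʳ-≤ ℚ.∣ S n k ℚ.- S m k ∣ (term≤c n k)))
             (c-halves n (ℕ.≤-trans M≤m (ℕ.≤′⇒≤ m≤n))) ⟩
      (ℚ.∣ S n k ℚ.- S m k ∣ ℚ.+ c n) ℚ.+ c n
        ≡⟨ ℚ.+-assoc ℚ.∣ S n k ℚ.- S m k ∣ (c n) (c n) ⟩
      ℚ.∣ S n k ℚ.- S m k ∣ ℚ.+ (c n ℚ.+ c n)
        ≤⟨ tail-bound k M≤m m≤n ⟩
      c m ℚ.+ c m ∎
      where
      open ℚ.≤-Reasoning
      t = seq (expTerm x n) k

    uniform : ∀ ε → 0ℚ ℚ.< ε → ∃ λ N → ∀ n → N ℕ.≤ n → ∀ k → ℚ.∣ S n k ℚ.- S N k ∣ ℚ.< ε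
    uniform ε 0<ε =
      let δ , 0<δ , eq = quotient (*-pos 0<B (0<c M)) 0<ε
          K , small = 1/1+n-small (½ ℚ.* (½ ℚ.* δ)) (½ε>0 (½ε>0 0<δ))
          P = M ℕ.⊔ K
          M≤P = ℕ.m≤m⊔n M K
          N = suc P
          cN≤ : c N ℚ.≤ (B ℚ.* c M) ℚ.* (½ ℚ.* (½ ℚ.* δ))
          cN≤ = *-mono-≤ (ℚ.<⇒≤ (*-pos 0<B (0<c M))) (ℚ.<⇒≤ (0<1/1+n P))
            (ℚ.*-monoˡ-≤-nonNeg B {{ℚ.nonNegative 0≤B}} (c-decreasing (ℕ.≤⇒≤′ M≤P)))
            (small P (ℕ.m≤n⊔m M K))
          2cN<ε : c N ℚ.+ c N ℚ.< ε
          2cN<ε = ℚ.≤-<-trans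
            (subst (c N ℚ.+ c N ℚ.≤_)
              (trans
                (solve 2 (λ a d → a :* (con ½ :* (con ½ :* d)) :+ a :* (con ½ :* (con ½ :* d))
                  := con ½ :* (a :* d)) refl (B ℚ.* c M) δ)
                (cong (½ ℚ.*_) eq))
              (ℚ.+-mono-≤ cN≤ cN≤))
            (½ε<ε 0<ε)
      in N , λ n N≤n k → ℚ.≤-<-trans
        (ℚ.≤-trans
          (subst (ℚ._≤ ℚ.∣ S n k ℚ.- S N k ∣ ℚ.+ (c n ℚ.+ c n)) (ℚ.+-identityʳ _)
            (ℚ.+-monoʳ-≤ ℚ.∣ S n k ℚ.- S N k ∣
              (ℚ.<⇒≤ (+-pos (0<c n) (0<c n)))))
          (tail-bound k (ℕ.≤-trans M≤P (ℕ.n≤1+n P)) (ℕ.≤⇒≤′ N≤n)))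
        2cN<ε

open ExpLemmas

opaque

  exp-series : ∀ x → ∃ λ y → HasSum (expTerm x) y
  exp-series x =
    uniform-limit (λ N → ∑[ n < N ] expTerm x (toℕ n)) (ExpConvergence.uniform x)

exp : ℝ → ℝ
exp x = proj₁ (exp-series x)

e : ℝ
e = exp 1#

------------------------------------------------------------------------
-- Reciprocals of positive reals

opaque

  reciprocal : ∀ x → 0# < x → ∃ λ y → x * y ≈ 1#
  reciprocal x (δ , 0<δ , N , δ≤x) = mkℝ v cauchy-v , inverse
    where
    u v : ℕ → ℚ
    u n = δ ℚ.⊔ seq x n

    δ≤u : ∀ n → δ ℚ.≤ u n
    δ≤u n = ℚ.p≤p⊔q δ (seq x n)

    0<u : ∀ n → 0ℚ ℚ.< u n
    0<u n = ℚ.<-≤-trans 0<δ (δ≤u n)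

    v n = ℚ.1/_ (u n) {{ℚ.>-nonZero (0<u n)}}

    uv : ∀ n → u n ℚ.* v n ≡ 1ℚ
    uv n = ℚ.*-inverseʳ (u n) {{ℚ.>-nonZero (0<u n)}}

    u≡x : ∀ n → N ℕ.≤ n → u n ≡ seq x n
    u≡x n N≤n = ℚ.p≤q⇒p⊔q≡q (subst (ℚ._≤ seq x n) (ℚ.+-identityˡ δ) (δ≤x n N≤n))

    cauchy-v : IsCauchy v
    cauchy-v ε 0<ε =
      let K , close = cauchy x (ε ℚ.* (δ ℚ.* δ)) (*-pos 0<ε (*-pos 0<δ 0<δ))
          l = λ {n} → ℕ.≤-trans {k = n} (ℕ.m≤m⊔n N K)
          r = λ {n} → ℕ.≤-trans {k = n} (ℕ.m≤n⊔m N K)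
      in N ℕ.⊔ K , λ m n m≥ n≥ →
        let w = u m ℚ.* u n
            0<w = *-pos (0<u m) (0<u n)
            open ℚ.≤-Reasoning
        in ℚ.*-cancelʳ-<-nonNeg w {{ℚ.nonNegative (ℚ.<⇒≤ 0<w)}} (begin-strict
          ℚ.∣ v m ℚ.- v n ∣ ℚ.* w
            ≡⟨ cong (ℚ.∣ v m ℚ.- v n ∣ ℚ.*_) (sym (ℚ.0≤p⇒∣p∣≡p (ℚ.<⇒≤ 0<w))) ⟩
          ℚ.∣ v m ℚ.- v n ∣ ℚ.* ℚ.∣ w ∣
            ≡⟨ sym (ℚ.∣p*q∣≡∣p∣*∣q∣ (v m ℚ.- v n) w) ⟩
          ℚ.∣ (v m ℚ.- v n) ℚ.* w ∣
            ≡⟨ cong ℚ.∣_∣ (trans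
                 (solve 4 (λ a b p q → (p :- q) :* (a :* b) := b :* (a :* p) :- a :* (b :* q))
                   refl (u m) (u n) (v m) (v n))
                 (cong₂ (λ p q → u n ℚ.* p ℚ.- u m ℚ.* q) (uv m) (uv n))) ⟩
          ℚ.∣ u n ℚ.* 1ℚ ℚ.- u m ℚ.* 1ℚ ∣
            ≡⟨ cong₂ (λ p q → ℚ.∣ p ℚ.- q ∣)
                 (trans (ℚ.*-identityʳ (u n)) (u≡x n (l n≥)))
                 (trans (ℚ.*-identityʳ (u m)) (u≡x m (l m≥))) ⟩
          ℚ.∣ seq x n ℚ.- seq x m ∣
            <⟨ close n m (r n≥) (r m≥) ⟩
          ε ℚ.* (δ ℚ.* δ)
            ≤⟨ ℚ.*-monoˡ-≤-nonNeg ε {{ℚ.nonNegative (ℚ.<⇒≤ 0<ε)}}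
                 (*-mono-≤ (ℚ.<⇒≤ (0<u m)) (ℚ.<⇒≤ 0<δ) (δ≤u m) (δ≤u n)) ⟩
          ε ℚ.* w ∎)

    inverse : x * mkℝ v cauchy-v ≈ 1#
    inverse ε 0<ε = N , λ n N≤n → subst (ℚ._< ε)
      (sym (trans
        (cong (λ t → ℚ.∣ t ℚ.- 1ℚ ∣) (trans (cong (ℚ._* v n) (sym (u≡x n N≤n))) (uv n)))
        (∣p-p∣≡0 1ℚ)))
      0<ε

infix 8 _⁻¹⟨_⟩

_⁻¹⟨_⟩ : ∀ x → 0# < x → ℝ
x ⁻¹⟨ 0<x ⟩ = proj₁ (reciprocal x 0<x)

0<e : 0# < e
0<e =
  let N , close = proj₂ (exp-series 1#) (fromℚ ½) (½ , ℚ.positive⁻¹ ½ , 0 , λ _ _ → ℚ.≤-refl)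
      δ , 0<δ , K , bound = close (suc N) (ℕ.n≤1+n N)
  in ½ , ℚ.positive⁻¹ ½ , K , λ k K≤k →
    let p = seq (∑[ n < suc N ] expTerm 1# (toℕ n)) k
        q = seq e k
        d = ℚ.∣ p ℚ.- q ∣
        open ℚ.≤-Reasoning
    in begin
      ½
        ≡⟨⟩
      1ℚ ℚ.- ½
        ≤⟨ ℚ.+-mono-≤ (1≤partial N k)
             (ℚ.neg-antimono-≤ (ℚ.≤-trans
               (subst (ℚ._≤ d ℚ.+ δ) (ℚ.+-identityʳ d) (ℚ.+-monoʳ-≤ d (ℚ.<⇒≤ 0<δ)))
               (bound k K≤k))) ⟩
      p ℚ.- d
        ≤⟨ ℚ.+-monoˡ-≤ (ℚ.- d) (p≤q+d p q) ⟩
      (q ℚ.+ d) ℚ.- d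
        ≡⟨ solve 2 (λ q d → (q :+ d) :- d := q) refl q d ⟩
      q ∎
  where
  p≤∣p∣ : ∀ p → p ℚ.≤ ℚ.∣ p ∣
  p≤∣p∣ p with ℚ.≤-total 0ℚ p
  ... | inj₁ 0≤p = ℚ.≤-reflexive (sym (ℚ.0≤p⇒∣p∣≡p 0≤p))
  ... | inj₂ p≤0 = ℚ.≤-trans p≤0 (ℚ.0≤∣p∣ p)

  p≤q+d : ∀ p q → p ℚ.≤ q ℚ.+ ℚ.∣ p ℚ.- q ∣
  p≤q+d p q = subst (ℚ._≤ q ℚ.+ ℚ.∣ p ℚ.- q ∣)
    (solve 2 (λ p q → q :+ (p :- q) := p) refl p q)
    (ℚ.+-monoʳ-≤ q (p≤∣p∣ (p ℚ.- q)))

  1^n : ∀ n k → seq (1# ^ n) k ≡ 1ℚ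
  1^n zero    k = refl
  1^n (suc n) k = trans (ℚ.*-identityˡ _) (1^n n k)

  0≤term : ∀ n k → 0ℚ ℚ.≤ seq (expTerm 1# n) k
  0≤term n k = subst (0ℚ ℚ.≤_)
    (sym (trans (cong (ℚ._* seq (1/ n !) k) (1^n n k)) (ℚ.*-identityˡ _)))
    (ℚ.nonNegative⁻¹ (seq (1/ n !) k) {{ℚ.normalize-nonNeg 1 (n !) {{n ℕ.!≢0}}}})

  1≤sum : ∀ (f : ℕ → ℝ) k → 1ℚ ℚ.≤ seq (f 0) k → (∀ n → 0ℚ ℚ.≤ seq (f n) k) →
          ∀ N → 1ℚ ℚ.≤ seq (∑[ n < suc N ] f (toℕ n)) k
  1≤sum f k 1≤f₀ 0≤f zero    = subst (1ℚ ℚ.≤_) (sym (ℚ.+-identityʳ (seq (f 0) k))) 1≤f₀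
  1≤sum f k 1≤f₀ 0≤f (suc N) = subst (1ℚ ℚ.≤_) (sym (sum-last (suc N) f k))
    (subst (ℚ._≤ s ℚ.+ seq (f (suc N)) k) (ℚ.+-identityʳ 1ℚ)
      (ℚ.+-mono-≤ (1≤sum f k 1≤f₀ 0≤f N) (0≤f (suc N))))
    where s = seq (∑[ n < suc N ] f (toℕ n)) k

  1≤partial : ∀ N k → 1ℚ ℚ.≤ seq (∑[ n < suc N ] expTerm 1# (toℕ n)) k
  1≤partial N k = 1≤sum (expTerm 1#) k ℚ.≤-refl (λ n → 0≤term n k) N

------------------------------------------------------------------------
-- Complex numbers

record ℂ : Set where
  constructor _+i_
  field
    re im : ℝ

∣_∣² : ℂ → ℝ
∣ x +i y ∣² = x ^ 2 + y ^ 2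

------------------------------------------------------------------------
-- Falling factorials

-- (x)ₘ = x (x - 1) ⋯ (x - m + 1)
falling : ℝ → ℕ → ℝ
falling x zero    = 1#
falling x (suc m) = falling x m * (x - fromℕ m)

-- (y)ₖ,λ = y (y - λ) ⋯ (y - (k - 1)λ)
degenerateFalling : ℝ → ℝ → ℕ → ℝ
degenerateFalling lam y zero    = 1#
degenerateFalling lam y (suc k) = degenerateFalling lam y k * (y - fromℕ k * lam)

------------------------------------------------------------------------
-- Differential operators, acting on real polynomials

-- Coefficients in increasing degree; trailing zeros are allowed, so polynomials
-- are compared with _≈ₚ_.
Poly : Set
Poly = List ℝ

coeff : Poly → ℕ → ℝ
coeff []      n       = 0#
coeff (a ∷ p) zero    = a
coeff (a ∷ p) (suc n) = coeff p n

infix  4 _≈ₚ_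
infixl 6 _+ₚ_
infixl 7 _·ₚ_

_≈ₚ_ : Poly → Poly → Set
p ≈ₚ q = ∀ n → coeff p n ≈ coeff q n

_+ₚ_ : Poly → Poly → Poly
[]      +ₚ q       = q
(a ∷ p) +ₚ []      = a ∷ p
(a ∷ p) +ₚ (b ∷ q) = a + b ∷ p +ₚ q

_·ₚ_ : ℝ → Poly → Poly
a ·ₚ p = map (a *_) p

open Endo Poly public using () renaming (Endo to Operator; _^_ to _^ᵒ_)

X : Operator
X p = 0# ∷ p

-- Leibniz: (a + x p)′ = p + x p′
D : Operator
D []      = []
D (a ∷ p) = p +ₚ X (D p)

xD : ℕ → Operator
xD j p = (X ^ᵒ j) ((D ^ᵒ j) p)

-- ∏ᵢ₌₀ᵏ⁻¹ (xʳDʳ - iλ); the factors commute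
degeneratePower : ℝ → ℕ → ℕ → Operator
degeneratePower lam r zero    p = p
degeneratePower lam r (suc k) p = xD r q +ₚ (- (fromℕ k * lam)) ·ₚ q
  where q = degeneratePower lam r k p

-- S j is the coefficient of xʲDʲ.  Differential operators with polynomial
-- coefficients over ℝ act faithfully on ℝ[x], so comparing the two sides on all
-- polynomials is the operator identity.
IsNormalOrdering : ℝ → (r k : ℕ) → Vector ℝ (suc (k ℕ.* r)) → Set
IsNormalOrdering lam r k S = ∀ p →
  degeneratePower lam r k p ≈ₚ foldr _+ₚ_ [] (λ j → S j ·ₚ xD (toℕ j) p)

-- φ(x) = ∑ⱼ S(j) xʲ
φ : ∀ {n} → Vector ℝ (suc n) → ℝ → ℝ
φ {n} S x = ∑[ j ≤ n ] (S j * x ^ toℕ j)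

{-# OPTIONS --safe #-}
module Submission where

-- The operators xʲDʲ and ∏ᵢ (xʳDʳ - iλ) are diagonal in the basis of monomials, with
-- eigenvalues (n)ⱼ and ((n)ᵣ)ₖ,λ on xⁿ; hence ((n)ᵣ)ₖ,λ = ∑ⱼ S(j) (n)ⱼ for every n.
-- Since ∑ₙ (n)ⱼ xⁿ / n! = xʲ eˣ, this gives ∑ₙ ((n)ᵣ)ₖ,λ xⁿ / n! = φ(x) eˣ, whose term
-- at n = 0 vanishes because r, k ≥ 1.  Dividing by eˣ requires e⁻ˣ eˣ = 1, a case of
-- eˣ eʸ = eˣ⁺ʸ: if |x|, |y| ≤ B then the product of the n-th partial sums of eˣ and eʸ
-- differs from that of eˣ⁺ʸ by at most the sum of the terms n, …, 2n - 1 of e²ᴮ.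

open import Defs
open import Data.Nat.Base using (ℕ; zero; suc)
import Data.Nat.Base as ℕ
open import Data.Product.Base using (∃; _×_; _,_; proj₁; proj₂)
open import Data.Vec.Functional using (Vector; foldr)
open import Algebra.Bundles using (CommutativeRing)
open import Algebra.Structures using (IsCommutativeRing)
open import Data.Fin.Base as Fin using (toℕ)
open import Data.Integer.Base as ℤ using (+_)
import Data.Integer.Properties as ℤ
open import Data.List.Base using ([]; _∷_)
import Data.Nat.Properties as ℕ
open import Data.Rational.Base as ℚ using (ℚ; 0ℚ; 1ℚ; ½)
import Data.Rational.Properties as ℚ
open import Data.Rational.Solver using (module +-*-Solver)
import Data.Rational.Unnormalised.Base as ℚᵘ
import Data.Rational.Unnormalised.Properties as ℚᵘ
open import Data.Sum.Base using (inj₁; inj₂)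
open import Function.Base using (_∘_)
open import Level using (0ℓ)
open import Relation.Binary.PropositionalEquality as ≡ using (_≡_; cong; cong₂; subst)

open +-*-Solver using (solve; _:=_; _:+_; _:*_; _:-_; :-_; con)
open Estimates
open SeriesLemmas
open ExpLemmas

-- Rational exponential sums

natℚ : ℕ → ℚ
natℚ n = + n ℚ./ 1

natℚ-suc : ∀ n → natℚ (suc n) ≡ natℚ n ℚ.+ 1ℚ
natℚ-suc n = ℚ.toℚᵘ-injective (ℚᵘ.≃-trans (toℚᵘ-/ (+ suc n) 0) (ℚᵘ.≃-sym (ℚᵘ.≃-trans
  (ℚ.toℚᵘ-homo-+ (natℚ n) 1ℚ)
  (ℚᵘ.≃-trans (ℚᵘ.+-congˡ (ℚ.toℚᵘ 1ℚ) (toℚᵘ-/ (+ n) 0))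
    (ℚᵘ.*≡* (cong (ℤ._* + 1) (≡.trans (cong (ℤ._+ + 1) (ℤ.*-identityʳ (+ n)))
      (ℤ.+-comm (+ n) (+ 1)))))))))

natℚ*1/1+n≡1 : ∀ n → natℚ (suc n) ℚ.* (1/1+ n) ≡ 1ℚ
natℚ*1/1+n≡1 n = ℚ.toℚᵘ-injective (ℚᵘ.≃-trans
  (ℚ.toℚᵘ-homo-* (natℚ (suc n)) (1/1+ n))
  (ℚᵘ.≃-trans (ℚᵘ.*-cong (toℚᵘ-/ (+ suc n) 0) (toℚᵘ-/ (+ 1) n))
    (ℚᵘ.*≡* (≡.trans (ℤ.*-identityʳ (+ suc n ℤ.* + 1))
      (≡.trans (ℤ.*-comm (+ suc n) (+ 1))
        (cong (λ m → + 1 ℤ.* (+ suc m)) (≡.sym (ℕ.+-identityʳ n))))))))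

-- The newest term is added on the right, so that a difference of two partial sums grows by one term
-- at each step of `≤′`, and `sum-last` matches it to the sums of reals.
psum : (ℕ → ℚ) → ℕ → ℚ
psum f zero    = 0ℚ
psum f (suc n) = psum f n ℚ.+ f n

psum-cong : ∀ {f g} → (∀ n → f n ≡ g n) → ∀ n → psum f n ≡ psum g n
psum-cong f≡g zero    = ≡.refl
psum-cong f≡g (suc n) = cong₂ ℚ._+_ (psum-cong f≡g n) (f≡g n)

psum-head : ∀ f n → psum f (suc n) ≡ f 0 ℚ.+ psum (f ∘ suc) n
psum-head f zero    = ℚ.+-comm 0ℚ (f 0)
psum-head f (suc n) = ≡.trans (cong (ℚ._+ f (suc n)) (psum-head f n)) (ℚ.+-assoc (f 0) _ _)

psum-mono : ∀ {f} → (∀ i → 0ℚ ℚ.≤ f i) → ∀ {m n} → m ℕ.≤′ n → psum f m ℚ.≤ psum f n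
psum-mono 0≤f ℕ.≤′-refl = ℚ.≤-refl
psum-mono {f} 0≤f {m} (ℕ.≤′-step {n} m≤n) = ℚ.≤-trans (psum-mono 0≤f m≤n)
  (subst (ℚ._≤ psum f n ℚ.+ f n) (ℚ.+-identityʳ (psum f n)) (ℚ.+-monoʳ-≤ (psum f n) (0≤f n)))

0≤psum : ∀ {f} → (∀ i → 0ℚ ℚ.≤ f i) → ∀ n → 0ℚ ℚ.≤ psum f n
0≤psum 0≤f n = psum-mono 0≤f (ℕ.≤⇒≤′ (ℕ.z≤n {n}))

-- The triangle inequality over the block of indices from m to n - 1. Writing the bound as a
-- difference of partial sums of `F` keeps it in the form that `square-triangle-dist` recombines.
psum-dist : ∀ {f F} → (∀ i → ℚ.∣ f i ∣ ℚ.≤ F i) → ∀ {m n} → m ℕ.≤′ n →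
  ℚ.∣ psum f n ℚ.- psum f m ∣ ℚ.≤ psum F n ℚ.- psum F m
psum-dist {f} {F} f≤F {m} ℕ.≤′-refl = ℚ.≤-reflexive
  (≡.trans (∣p-p∣≡0 (psum f m)) (≡.sym (ℚ.+-inverseʳ (psum F m))))
psum-dist {f} {F} f≤F {m} (ℕ.≤′-step {n} m≤n) = begin
  ℚ.∣ (psum f n ℚ.+ f n) ℚ.- psum f m ∣
    ≡⟨ cong ℚ.∣_∣ (swap (psum f n) (f n) (psum f m)) ⟩
  ℚ.∣ (psum f n ℚ.- psum f m) ℚ.+ f n ∣
    ≤⟨ ℚ.∣p+q∣≤∣p∣+∣q∣ (psum f n ℚ.- psum f m) (f n) ⟩
  ℚ.∣ psum f n ℚ.- psum f m ∣ ℚ.+ ℚ.∣ f n ∣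
    ≤⟨ ℚ.+-mono-≤ (psum-dist f≤F m≤n) (f≤F n) ⟩
  (psum F n ℚ.- psum F m) ℚ.+ F n
    ≡⟨ ≡.sym (swap (psum F n) (F n) (psum F m)) ⟩
  (psum F n ℚ.+ F n) ℚ.- psum F m ∎
  where
  open ℚ.≤-Reasoning
  swap : ∀ a b c → (a ℚ.+ b) ℚ.- c ≡ (a ℚ.- c) ℚ.+ b
  swap = solve 3 (λ a b c → (a :+ b) :- c := (a :- c) :+ b) ≡.refl

-- Cauchy products of rational sequences

conv : (ℕ → ℚ) → (ℕ → ℚ) → ℕ → ℚ
conv f g zero    = f 0 ℚ.* g 0
conv f g (suc n) = f 0 ℚ.* g (suc n) ℚ.+ conv (f ∘ suc) g n

conv-cong : ∀ {f f′ g g′} → (∀ i → f i ≡ f′ i) → (∀ i → g i ≡ g′ i) →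
  ∀ n → conv f g n ≡ conv f′ g′ n
conv-cong f≡ g≡ zero    = cong₂ ℚ._*_ (f≡ 0) (g≡ 0)
conv-cong f≡ g≡ (suc n) =
  cong₂ ℚ._+_ (cong₂ ℚ._*_ (f≡ 0) (g≡ (suc n))) (conv-cong (f≡ ∘ suc) g≡ n)

-- The recursion of `conv` peels `f 0`; this peels `g 0` instead, for the case where it is the
-- second sequence that has to be shifted.
conv-last : ∀ f g n → conv f g (suc n) ≡ conv f (g ∘ suc) n ℚ.+ f (suc n) ℚ.* g 0
conv-last f g zero    = ≡.refl
conv-last f g (suc n) = ≡.trans
  (cong (f 0 ℚ.* g (suc (suc n)) ℚ.+_) (conv-last (f ∘ suc) g n))
  (≡.sym (ℚ.+-assoc (f 0 ℚ.* g (suc (suc n))) _ _))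

conv-scaleˡ : ∀ x f g n → conv (λ i → x ℚ.* f i) g n ≡ x ℚ.* conv f g n
conv-scaleˡ x f g zero    = ℚ.*-assoc x (f 0) (g 0)
conv-scaleˡ x f g (suc n) = ≡.trans
  (cong₂ ℚ._+_ (ℚ.*-assoc x (f 0) (g (suc n))) (conv-scaleˡ x (f ∘ suc) g n))
  (≡.sym (ℚ.*-distribˡ-+ x _ _))

conv-scaleʳ : ∀ x f g n → conv f (λ i → x ℚ.* g i) n ≡ x ℚ.* conv f g n
conv-scaleʳ x f g zero    = solve 3 (λ x a b → a :* (x :* b) := x :* (a :* b)) ≡.refl x (f 0) (g 0)
conv-scaleʳ x f g (suc n) = ≡.trans
  (cong (f 0 ℚ.* (x ℚ.* g (suc n)) ℚ.+_) (conv-scaleʳ x (f ∘ suc) g n))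
  (solve 4 (λ x a b c → a :* (x :* b) :+ x :* c := x :* (a :* b :+ c)) ≡.refl
    x (f 0) (g (suc n)) (conv (f ∘ suc) g n))

weight : ℚ → (ℕ → ℚ) → ℕ → ℚ
weight a f i = (a ℚ.+ natℚ i) ℚ.* f i

-- The Leibniz rule for power series: weight 0ℚ is the Euler operator x d/dx on
-- coefficients, and the offsets make the induction go through.
conv-weight : ∀ a b f g n →
  conv (weight a f) g n ℚ.+ conv f (weight b g) n ≡ ((a ℚ.+ b) ℚ.+ natℚ n) ℚ.* conv f g n
conv-weight a b f g zero =
  solve 4 (λ a b x y → ((a :+ con 0ℚ) :* x) :* y :+ x :* ((b :+ con 0ℚ) :* y)
    := ((a :+ b) :+ con 0ℚ) :* (x :* y)) ≡.refl a b (f 0) (g 0)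
conv-weight a b f g (suc n) = begin
  (p ℚ.+ conv (weight a f ∘ suc) g n) ℚ.+ (q ℚ.+ conv f′ (weight b g) n)
    ≡⟨ cong (λ c → (p ℚ.+ c) ℚ.+ (q ℚ.+ conv f′ (weight b g) n))
         (conv-cong {g = g} shift (λ _ → ≡.refl) n) ⟩
  (p ℚ.+ conv (weight (a ℚ.+ 1ℚ) f′) g n) ℚ.+ (q ℚ.+ conv f′ (weight b g) n)
    ≡⟨ solve 4 (λ p c q d → (p :+ c) :+ (q :+ d) := (p :+ q) :+ (c :+ d)) ≡.refl
         p (conv (weight (a ℚ.+ 1ℚ) f′) g n) q (conv f′ (weight b g) n) ⟩
  (p ℚ.+ q) ℚ.+ (conv (weight (a ℚ.+ 1ℚ) f′) g n ℚ.+ conv f′ (weight b g) n)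
    ≡⟨ cong ((p ℚ.+ q) ℚ.+_) (conv-weight (a ℚ.+ 1ℚ) b f′ g n) ⟩
  (p ℚ.+ q) ℚ.+ (((a ℚ.+ 1ℚ) ℚ.+ b) ℚ.+ natℚ n) ℚ.* conv f′ g n
    ≡⟨ cong (λ m → (((a ℚ.+ 0ℚ) ℚ.* f 0) ℚ.* g (suc n) ℚ.+ f 0 ℚ.* ((b ℚ.+ m) ℚ.* g (suc n)))
               ℚ.+ (((a ℚ.+ 1ℚ) ℚ.+ b) ℚ.+ natℚ n) ℚ.* conv f′ g n) (natℚ-suc n) ⟩
  _ ≡⟨ solve 6 (λ a b m x y c →
         (((a :+ con 0ℚ) :* x) :* y :+ x :* ((b :+ (m :+ con 1ℚ)) :* y))
           :+ (((a :+ con 1ℚ) :+ b) :+ m) :* c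
         := ((a :+ b) :+ (m :+ con 1ℚ)) :* (x :* y :+ c)) ≡.refl
         a b (natℚ n) (f 0) (g (suc n)) (conv f′ g n) ⟩
  ((a ℚ.+ b) ℚ.+ (natℚ n ℚ.+ 1ℚ)) ℚ.* conv f g (suc n)
    ≡⟨ cong (λ m → ((a ℚ.+ b) ℚ.+ m) ℚ.* conv f g (suc n)) (≡.sym (natℚ-suc n)) ⟩
  ((a ℚ.+ b) ℚ.+ natℚ (suc n)) ℚ.* conv f g (suc n) ∎
  where
  open ≡.≡-Reasoning
  f′ = f ∘ suc
  p = weight a f 0 ℚ.* g (suc n)
  q = f 0 ℚ.* weight b g (suc n)
  shift : ∀ i → weight a f (suc i) ≡ weight (a ℚ.+ 1ℚ) f′ i
  shift i = cong (ℚ._* f′ i) (≡.trans (cong (a ℚ.+_) (natℚ-suc i))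
    (solve 2 (λ a m → a :+ (m :+ con 1ℚ) := (a :+ con 1ℚ) :+ m) ≡.refl a (natℚ i)))

-- The row i = 0 is split off the triangle i + j ≤ n; moving the remaining rows down by one gives a
-- triangle with one row fewer.
psum-conv : ∀ f g n →
  psum (conv f g) (suc n) ≡ f 0 ℚ.* psum g (suc n) ℚ.+ psum (conv (f ∘ suc) g) n
psum-conv f g zero    =
  solve 2 (λ x y → con 0ℚ :+ x :* y := x :* (con 0ℚ :+ y) :+ con 0ℚ) ≡.refl (f 0) (g 0)
psum-conv f g (suc n) = ≡.trans
  (cong (ℚ._+ conv f g (suc n)) (psum-conv f g n))
  (solve 5 (λ x s t y c → (x :* s :+ t) :+ (x :* y :+ c) := x :* (s :+ y) :+ (t :+ c)) ≡.refl
    (f 0) (psum g (suc n)) (psum (conv (f ∘ suc) g) n) (g (suc n)) (conv (f ∘ suc) g n))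

psum-*-head : ∀ f g m n →
  psum f (suc m) ℚ.* psum g n ≡ f 0 ℚ.* psum g n ℚ.+ psum (f ∘ suc) m ℚ.* psum g n
psum-*-head f g m n = ≡.trans (cong (ℚ._* psum g n) (psum-head f m)) 
  (ℚ.*-distribʳ-+ (psum g n) (f 0) (psum (f ∘ suc) m))

0≤* : ∀ {p q} → 0ℚ ℚ.≤ p → 0ℚ ℚ.≤ q → 0ℚ ℚ.≤ p ℚ.* q
0≤* {p} {q} 0≤p 0≤q = ℚ.nonNegative⁻¹ (p ℚ.* q)
  {{ℚ.nonNeg*nonNeg⇒nonNeg p {{ℚ.nonNegative 0≤p}} q {{ℚ.nonNegative 0≤q}}}}

0≤conv : ∀ {f g} → (∀ i → 0ℚ ℚ.≤ f i) → (∀ i → 0ℚ ℚ.≤ g i) → ∀ n → 0ℚ ℚ.≤ conv f g n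
0≤conv 0≤f 0≤g zero    = 0≤* (0≤f 0) (0≤g 0)
0≤conv 0≤f 0≤g (suc n) = ℚ.+-mono-≤ (0≤* (0≤f 0) (0≤g (suc n))) (0≤conv (0≤f ∘ suc) 0≤g n)

-- The square of indices i < m, j < n lies in the triangle i + j < l.
square≤triangle : ∀ {f g} → (∀ i → 0ℚ ℚ.≤ f i) → (∀ i → 0ℚ ℚ.≤ g i) →
  ∀ m n {l} → m ℕ.+ n ℕ.≤ l → psum f m ℚ.* psum g n ℚ.≤ psum (conv f g) l
square≤triangle {f} {g} 0≤f 0≤g zero n {l} _ =
  subst (ℚ._≤ psum (conv f g) l) (≡.sym (ℚ.*-zeroˡ (psum g n))) (0≤psum (0≤conv 0≤f 0≤g) l)
square≤triangle {f} {g} 0≤f 0≤g (suc m) n {suc l} (ℕ.s≤s m+n≤l) = begin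
  psum f (suc m) ℚ.* psum g n
    ≡⟨ psum-*-head f g m n ⟩
  f 0 ℚ.* psum g n ℚ.+ psum (f ∘ suc) m ℚ.* psum g n
    ≤⟨ ℚ.+-mono-≤
         (ℚ.*-monoˡ-≤-nonNeg (f 0) {{ℚ.nonNegative (0≤f 0)}}
           (psum-mono 0≤g (ℕ.≤⇒≤′ (ℕ.≤-trans (ℕ.m≤n+m n m) (ℕ.m≤n⇒m≤1+n m+n≤l)))))
         (square≤triangle (0≤f ∘ suc) 0≤g m n m+n≤l) ⟩
  f 0 ℚ.* psum g (suc l) ℚ.+ psum (conv (f ∘ suc) g) l
    ≡⟨ ≡.sym (psum-conv f g l) ⟩
  psum (conv f g) (suc l) ∎
  where open ℚ.≤-Reasoning

-- As l ≤ m and l ≤ n, the triangle i + j < l lies inside the rectangle i < m, j < n, so the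
-- difference is a sum of f i * g j over the indices left over, each at most F i * G j in absolute
-- value. The induction removes the row i = 0 from both regions.
square-triangle-dist : ∀ {f g F G} → (∀ i → ℚ.∣ f i ∣ ℚ.≤ F i) → (∀ i → ℚ.∣ g i ∣ ℚ.≤ G i) →
  ∀ {m n l} → l ℕ.≤ m → l ℕ.≤ n →
  ℚ.∣ psum f m ℚ.* psum g n ℚ.- psum (conv f g) l ∣ ℚ.≤
  psum F m ℚ.* psum G n ℚ.- psum (conv F G) l
square-triangle-dist {f} {g} {F} {G} f≤F g≤G {m} {n} {zero} _ _ = begin
  ℚ.∣ psum f m ℚ.* psum g n ℚ.- 0ℚ ∣
    ≡⟨ cong ℚ.∣_∣ (ℚ.+-identityʳ _) ⟩
  ℚ.∣ psum f m ℚ.* psum g n ∣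
    ≡⟨ ℚ.∣p*q∣≡∣p∣*∣q∣ (psum f m) (psum g n) ⟩
  ℚ.∣ psum f m ∣ ℚ.* ℚ.∣ psum g n ∣
    ≤⟨ *-mono-≤ (ℚ.≤-trans (ℚ.0≤∣p∣ (psum f m)) (bound f≤F m)) (ℚ.0≤∣p∣ (psum g n))
         (bound f≤F m) (bound g≤G n) ⟩
  psum F m ℚ.* psum G n
    ≡⟨ ≡.sym (ℚ.+-identityʳ _) ⟩
  psum F m ℚ.* psum G n ℚ.- 0ℚ ∎
  where
  open ℚ.≤-Reasoning
  bound : ∀ {f F} → (∀ i → ℚ.∣ f i ∣ ℚ.≤ F i) → ∀ n → ℚ.∣ psum f n ∣ ℚ.≤ psum F n
  bound {f} {F} f≤F n = ≡.subst₂ (λ p q → ℚ.∣ p ∣ ℚ.≤ q)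
    (ℚ.+-identityʳ (psum f n)) (ℚ.+-identityʳ (psum F n)) (psum-dist f≤F (ℕ.≤⇒≤′ (ℕ.z≤n {n})))
square-triangle-dist {f} {g} {F} {G} f≤F g≤G {suc m} {n} {suc l} (ℕ.s≤s l≤m) l<n = begin
  ℚ.∣ psum f (suc m) ℚ.* psum g n ℚ.- psum (conv f g) (suc l) ∣
    ≡⟨ cong ℚ.∣_∣ (split f g) ⟩
  ℚ.∣ f 0 ℚ.* (psum g n ℚ.- psum g (suc l))
      ℚ.+ (psum (f ∘ suc) m ℚ.* psum g n ℚ.- psum (conv (f ∘ suc) g) l) ∣
    ≤⟨ ℚ.∣p+q∣≤∣p∣+∣q∣ (f 0 ℚ.* (psum g n ℚ.- psum g (suc l))) _ ⟩
  ℚ.∣ f 0 ℚ.* (psum g n ℚ.- psum g (suc l)) ∣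
      ℚ.+ ℚ.∣ psum (f ∘ suc) m ℚ.* psum g n ℚ.- psum (conv (f ∘ suc) g) l ∣
    ≡⟨ cong (ℚ._+ ℚ.∣ psum (f ∘ suc) m ℚ.* psum g n ℚ.- psum (conv (f ∘ suc) g) l ∣)
         (ℚ.∣p*q∣≡∣p∣*∣q∣ (f 0) (psum g n ℚ.- psum g (suc l))) ⟩
  ℚ.∣ f 0 ∣ ℚ.* ℚ.∣ psum g n ℚ.- psum g (suc l) ∣
      ℚ.+ ℚ.∣ psum (f ∘ suc) m ℚ.* psum g n ℚ.- psum (conv (f ∘ suc) g) l ∣
    ≤⟨ ℚ.+-mono-≤
         (*-mono-≤ (ℚ.≤-trans (ℚ.0≤∣p∣ (f 0)) (f≤F 0)) (ℚ.0≤∣p∣ _)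
           (f≤F 0) (psum-dist g≤G (ℕ.≤⇒≤′ l<n)))
         (square-triangle-dist (f≤F ∘ suc) g≤G l≤m (ℕ.<⇒≤ l<n)) ⟩
  F 0 ℚ.* (psum G n ℚ.- psum G (suc l))
      ℚ.+ (psum (F ∘ suc) m ℚ.* psum G n ℚ.- psum (conv (F ∘ suc) G) l)
    ≡⟨ ≡.sym (split F G) ⟩
  psum F (suc m) ℚ.* psum G n ℚ.- psum (conv F G) (suc l) ∎
  where
  open ℚ.≤-Reasoning
  split : ∀ f g → psum f (suc m) ℚ.* psum g n ℚ.- psum (conv f g) (suc l) ≡
    f 0 ℚ.* (psum g n ℚ.- psum g (suc l))
      ℚ.+ (psum (f ∘ suc) m ℚ.* psum g n ℚ.- psum (conv (f ∘ suc) g) l)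
  split f g = ≡.trans
    (cong₂ ℚ._-_ (psum-*-head f g m n) (psum-conv f g l))
    (solve 5 (λ x a b s t → (x :* a :+ s) :- (x :* b :+ t) := x :* (a :- b) :+ (s :- t)) ≡.refl
      (f 0) (psum g n) (psum g (suc l)) (psum (f ∘ suc) m ℚ.* psum g n)
      (psum (conv (f ∘ suc) g) l))

-- The exponential series at a rational argument

expTermℚ : ℚ → ℕ → ℚ
expTermℚ q zero    = 1ℚ
expTermℚ q (suc n) = (q ℚ.* expTermℚ q n) ℚ.* (1/1+ n)

-- On coefficients this is the differential equation x y′ = q x y satisfied by y = exp (q x).
weight-expTermℚ : ∀ q n → weight 0ℚ (expTermℚ q) (suc n) ≡ q ℚ.* expTermℚ q n
weight-expTermℚ q n = begin
  (0ℚ ℚ.+ ν) ℚ.* (p ℚ.* r)  ≡⟨ solve 3 (λ ν p r → (con 0ℚ :+ ν) :* (p :* r) := p :* (ν :* r))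
                                 ≡.refl ν p r ⟩
  p ℚ.* (ν ℚ.* r)           ≡⟨ cong (p ℚ.*_) (natℚ*1/1+n≡1 n) ⟩
  p ℚ.* 1ℚ                  ≡⟨ ℚ.*-identityʳ p ⟩
  p                         ∎
  where
  open ≡.≡-Reasoning
  ν = natℚ (suc n)
  p = q ℚ.* expTermℚ q n
  r = 1/1+ n

-- The binomial theorem without binomial coefficients: by the Leibniz rule `conv-weight` both sides
-- satisfy (n + 1) c(n + 1) = (p + q) c(n) with c(0) = 1.
expTermℚ-conv : ∀ p q n → conv (expTermℚ p) (expTermℚ q) n ≡ expTermℚ (p ℚ.+ q) n
expTermℚ-conv p q zero    = ≡.refl
expTermℚ-conv p q (suc n) = begin
  conv f g (suc n)
    ≡⟨ ≡.sym (ℚ.*-identityˡ _) ⟩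
  1ℚ ℚ.* conv f g (suc n)
    -- A factor (n + 1) / (n + 1) is inserted so that n + 1 can be read as the weight in the Leibniz
    -- rule.
    ≡⟨ cong (ℚ._* conv f g (suc n)) (≡.sym (natℚ*1/1+n≡1 n)) ⟩
  (ν ℚ.* r) ℚ.* conv f g (suc n)
    ≡⟨ solve 3 (λ ν r c → (ν :* r) :* c := (((con 0ℚ :+ con 0ℚ) :+ ν) :* c) :* r) ≡.refl
         ν r (conv f g (suc n)) ⟩
  (((0ℚ ℚ.+ 0ℚ) ℚ.+ ν) ℚ.* conv f g (suc n)) ℚ.* r
    ≡⟨ cong (ℚ._* r) (≡.sym (conv-weight 0ℚ 0ℚ f g (suc n))) ⟩
  (conv (weight 0ℚ f) g (suc n) ℚ.+ conv f (weight 0ℚ g) (suc n)) ℚ.* r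
    ≡⟨ cong (ℚ._* r) (cong₂ ℚ._+_ left right) ⟩
  (p ℚ.* conv f g n ℚ.+ q ℚ.* conv f g n) ℚ.* r
    ≡⟨ cong (ℚ._* r) (≡.sym (ℚ.*-distribʳ-+ (conv f g n) p q)) ⟩
  ((p ℚ.+ q) ℚ.* conv f g n) ℚ.* r
    ≡⟨ cong (λ c → ((p ℚ.+ q) ℚ.* c) ℚ.* r) (expTermℚ-conv p q n) ⟩
  expTermℚ (p ℚ.+ q) (suc n) ∎
  where
  open ≡.≡-Reasoning
  f = expTermℚ p
  g = expTermℚ q
  ν = natℚ (suc n)
  r = 1/1+ n
  -- The weight kills the term of index 0; on the others it amounts to a shift by one and a factor
  -- p.
  left : conv (weight 0ℚ f) g (suc n) ≡ p ℚ.* conv f g n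
  left = ≡.trans
    (cong₂ ℚ._+_ (ℚ.*-zeroˡ (g (suc n)))
      (≡.trans (conv-cong {g = g} (weight-expTermℚ p) (λ _ → ≡.refl) n) (conv-scaleˡ p f g n)))
    (ℚ.+-identityˡ _)
  right : conv f (weight 0ℚ g) (suc n) ≡ q ℚ.* conv f g n
  right = ≡.trans (conv-last f (weight 0ℚ g) n) (≡.trans
    (cong₂ ℚ._+_
      (≡.trans (conv-cong {f} (λ _ → ≡.refl) (weight-expTermℚ q) n) (conv-scaleʳ q f g n))
      (ℚ.*-zeroʳ (f (suc n))))
    (ℚ.+-identityʳ _))

∣expTermℚ∣≤ : ∀ {q B} → 0ℚ ℚ.≤ B → ℚ.∣ q ∣ ℚ.≤ B → ∀ n → ℚ.∣ expTermℚ q n ∣ ℚ.≤ expTermℚ B n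
∣expTermℚ∣≤ 0≤B q≤B zero = ℚ.≤-refl
∣expTermℚ∣≤ {q} {B} 0≤B q≤B (suc n) = begin
  ℚ.∣ (q ℚ.* t) ℚ.* r ∣
    ≡⟨ ℚ.∣p*q∣≡∣p∣*∣q∣ (q ℚ.* t) r ⟩
  ℚ.∣ q ℚ.* t ∣ ℚ.* ℚ.∣ r ∣
    ≡⟨ cong₂ ℚ._*_ (ℚ.∣p*q∣≡∣p∣*∣q∣ q t) (ℚ.0≤p⇒∣p∣≡p (ℚ.<⇒≤ (0<1/1+n n))) ⟩
  (ℚ.∣ q ∣ ℚ.* ℚ.∣ t ∣) ℚ.* r
    ≤⟨ ℚ.*-monoʳ-≤-nonNeg r {{ℚ.nonNegative (ℚ.<⇒≤ (0<1/1+n n))}}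
         (*-mono-≤ 0≤B (ℚ.0≤∣p∣ t) q≤B (∣expTermℚ∣≤ 0≤B q≤B n)) ⟩
  (B ℚ.* expTermℚ B n) ℚ.* r ∎
  where
  open ℚ.≤-Reasoning
  t = expTermℚ q n
  r = 1/1+ n

-- The partial sum for p + q is the triangle i + j < n of the double series, so the difference lives
-- on the rest of the n by n square. With `B` in place of p and q, that rest is contained in n ≤ i +
-- j < 2n, which gives terms of the series for B + B.
expSum-*-dist : ∀ {p q B} → 0ℚ ℚ.≤ B → ℚ.∣ p ∣ ℚ.≤ B → ℚ.∣ q ∣ ℚ.≤ B → ∀ n →
  ℚ.∣ psum (expTermℚ p) n ℚ.* psum (expTermℚ q) n ℚ.- psum (expTermℚ (p ℚ.+ q)) n ∣ ℚ.≤
  psum (expTermℚ (B ℚ.+ B)) (n ℕ.+ n) ℚ.- psum (expTermℚ (B ℚ.+ B)) n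
expSum-*-dist {p} {q} {B} 0≤B p≤B q≤B n = begin
  ℚ.∣ psum (expTermℚ p) n ℚ.* psum (expTermℚ q) n ℚ.- psum (expTermℚ (p ℚ.+ q)) n ∣
    ≡⟨ cong (λ s → ℚ.∣ psum (expTermℚ p) n ℚ.* psum (expTermℚ q) n ℚ.- s ∣)
         (≡.sym (psum-cong (expTermℚ-conv p q) n)) ⟩
  ℚ.∣ psum (expTermℚ p) n ℚ.* psum (expTermℚ q) n ℚ.- psum (conv (expTermℚ p) (expTermℚ q)) n ∣
    ≤⟨ square-triangle-dist (∣expTermℚ∣≤ 0≤B p≤B) (∣expTermℚ∣≤ 0≤B q≤B)
         (ℕ.≤-refl {n}) (ℕ.≤-refl {n}) ⟩
  psum F n ℚ.* psum F n ℚ.- psum (conv F F) n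
    ≤⟨ ℚ.+-monoˡ-≤ (ℚ.- psum (conv F F) n) (square≤triangle 0≤F 0≤F n n ℕ.≤-refl) ⟩
  psum (conv F F) (n ℕ.+ n) ℚ.- psum (conv F F) n
    ≡⟨ cong₂ ℚ._-_ (psum-cong (expTermℚ-conv B B) (n ℕ.+ n)) (psum-cong (expTermℚ-conv B B) n) ⟩
  psum (expTermℚ (B ℚ.+ B)) (n ℕ.+ n) ℚ.- psum (expTermℚ (B ℚ.+ B)) n ∎
  where
  open ℚ.≤-Reasoning
  F = expTermℚ B
  0≤F : ∀ i → 0ℚ ℚ.≤ F i
  -- With q = B the majorisation reads ∣ F i ∣ ≤ F i, which forces F i to be nonnegative.
  0≤F i = ℚ.≤-trans (ℚ.0≤∣p∣ _) (∣expTermℚ∣≤ 0≤B (ℚ.≤-reflexive (ℚ.0≤p⇒∣p∣≡p 0≤B)) i)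

-- Limits

infix 4 _≃_ _⇝_

-- Unlike those of _≈_, which unfolds to a function type, the arguments of _≃_ and
-- _⇝_ can be inferred by unification.
opaque
  _≃_ : ℝ → ℝ → Set
  _≃_ = _≈_

  ≃-isCommutativeRing : IsCommutativeRing _≃_ _+_ _*_ -_ 0# 1#
  ≃-isCommutativeRing = CommutativeRing.isCommutativeRing ℝ-commutativeRing

  ≈⇒≃ : ∀ {x y} → x ≈ y → x ≃ y
  ≈⇒≃ x≈y = x≈y

  ≃⇒≈ : ∀ {x y} → x ≃ y → x ≈ y
  ≃⇒≈ x≃y = x≃y

≃-commutativeRing : CommutativeRing 0ℓ 0ℓ
≃-commutativeRing = record { isCommutativeRing = ≃-isCommutativeRing }

open CommutativeRing ≃-commutativeRing
  using (setoid; semiring; +-cong; +-congˡ; +-congʳ; *-cong; *-congˡ; *-congʳ; *-assoc; *-comm;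
         +-identityˡ; +-identityʳ; *-identityˡ; *-identityʳ; zeroˡ; zeroʳ; distribʳ; -‿cong; -‿inverseˡ)
  renaming (refl to ≃-refl; sym to ≃-sym; trans to ≃-trans)
import Algebra.Properties.Semiring.Sum semiring as Sum
import Relation.Binary.Reasoning.Setoid setoid as ≃-Reasoning

pointwise-≃ : ∀ {x y} → (∀ k → seq x k ≡ seq y k) → x ≃ y
pointwise-≃ {x} {y} eq = ≈⇒≃ (pointwise x y eq)

-- The tolerance is rational, and the threshold for the index k of the approximating rationals is
-- chosen after n: no uniformity in n is asked.
record _⇝_ (s : ℕ → ℝ) (L : ℝ) : Set where
  constructor mk⇝
  field
    close : ∀ ε → 0ℚ ℚ.< ε → Eventually λ n → Eventually λ k →
      ℚ.∣ seq (s n) k ℚ.- seq L k ∣ ℚ.< ε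

open _⇝_

-- A constant real serves as tolerance; the gap δ contained in `_<_` on reals turns its non-strict
-- bound into a strict rational one.
⟶⇒⇝ : ∀ {s L} → s ⟶ L → s ⇝ L
⟶⇒⇝ {s} {L} s⟶L = mk⇝ λ ε 0<ε →
  let N , c = s⟶L (fromℚ ε) (ε , 0<ε , 0 , λ _ _ → ℚ.≤-reflexive (ℚ.+-identityˡ ε))
  in N , λ n N≤n →
    let δ , 0<δ , K , bound = c n N≤n
    in K , λ k K≤k → let d = ℚ.∣ seq (s n) k ℚ.- seq L k ∣ in ℚ.<-≤-trans
         (subst (ℚ._< d ℚ.+ δ) (ℚ.+-identityʳ d) (ℚ.+-monoʳ-< d 0<δ)) (bound k K≤k)

⇝⇒⟶ : ∀ {s L} → s ⇝ L → s ⟶ L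
⇝⇒⟶ {s} {L} s⇝L ε (δ , 0<δ , K , δ≤ε) =
  let N , c = close s⇝L _ (½ε>0 0<δ)
  -- One half of δ bounds the distance, the other is the gap that `_<_` requires.
  in N , λ n N≤n → ½ ℚ.* δ , ½ε>0 0<δ ,
    both (λ k d<½δ 0+δ≤ε → ℚ.≤-trans
           (ℚ.+-monoˡ-≤ (½ ℚ.* δ) (ℚ.<⇒≤ d<½δ))
           (subst (ℚ._≤ seq ε k) (≡.trans (ℚ.+-identityˡ δ) (≡.sym (halves δ))) 0+δ≤ε))
      (c n N≤n) (K , δ≤ε)

⇝-const : ∀ {x} → (λ _ → x) ⇝ x
⇝-const {x} = mk⇝ λ ε 0<ε → 0 , λ _ _ → ≃⇒≈ (≃-refl {x}) ε 0<ε

⇝-cong : ∀ {s t L} → (∀ n → s n ≃ t n) → s ⇝ L → t ⇝ L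
⇝-cong {s} {t} {L} s≃t s⇝L = mk⇝ λ ε 0<ε →
  let N , c = close s⇝L _ (½ε>0 0<ε)
  in N , λ n N≤n → both
    (λ k → halves-< ε (dist-triangle (seq (t n) k) (seq (s n) k) (seq L k)))
    (≃⇒≈ (≃-sym (s≃t n)) _ (½ε>0 0<ε)) (c n N≤n)

⇝-congʳ : ∀ {s L M} → L ≃ M → s ⇝ L → s ⇝ M
⇝-congʳ {s} {L} {M} L≃M s⇝L = mk⇝ λ ε 0<ε →
  let N , c = close s⇝L _ (½ε>0 0<ε)
  in N , λ n N≤n → both
    (λ k → halves-< ε (dist-triangle (seq (s n) k) (seq L k) (seq M k)))
    (c n N≤n) (≃⇒≈ L≃M _ (½ε>0 0<ε))

⇝-uniformly-close : ∀ {s t L} →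
  (∀ ε → 0ℚ ℚ.< ε → Eventually λ n → ∀ k → ℚ.∣ seq (t n) k ℚ.- seq (s n) k ∣ ℚ.< ε) →
  s ⇝ L → t ⇝ L
⇝-uniformly-close {s} {t} {L} t~s s⇝L = mk⇝ λ ε 0<ε → both
  (λ n t~s (K , c) → K , λ k K≤k →
    halves-< ε (dist-triangle (seq (t n) k) (seq (s n) k) (seq L k)) (t~s k) (c k K≤k))
  (t~s _ (½ε>0 0<ε)) (close s⇝L _ (½ε>0 0<ε))

⇝-unique : ∀ {s L M} → s ⇝ L → s ⇝ M → L ≃ M
⇝-unique {s} {L} {M} s⇝L s⇝M = ≈⇒≃ λ ε 0<ε →
  let N , c = both
        {R = λ n → Eventually λ k → ℚ.∣ seq L k ℚ.- seq M k ∣ ℚ.< ε}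
        (λ n → both λ k sL sM →
          halves-< ε (dist-triangle (seq L k) (seq (s n) k) (seq M k))
            (subst (ℚ._< ½ ℚ.* ε) (dist-sym (seq (s n) k) (seq L k)) sL) sM)
        (close s⇝L _ (½ε>0 0<ε)) (close s⇝M _ (½ε>0 0<ε))
  -- Any index past both thresholds serves, so the threshold itself is taken.
  in c N ℕ.≤-refl

⇝-+ : ∀ {s t L M} → s ⇝ L → t ⇝ M → (λ n → s n + t n) ⇝ (L + M)
⇝-+ {s} {t} {L} {M} s⇝L t⇝M = mk⇝ λ ε 0<ε → both
  (λ n → both λ k → halves-< ε (dist-+ (seq (s n) k) (seq (t n) k) (seq L k) (seq M k)))
  (close s⇝L _ (½ε>0 0<ε)) (close t⇝M _ (½ε>0 0<ε))

⇝-* : ∀ {s t L M} → s ⇝ L → t ⇝ M → (λ n → s n * t n) ⇝ (L * M)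
⇝-* {s} {t} {L} {M} s⇝L t⇝M = mk⇝ λ ε 0<ε →
  let B , 0<B , L≤B = bounded L
      C , 0<C , M≤C = bounded M
      0<1 = ℚ.positive⁻¹ 1ℚ
      0<C+1 = +-pos 0<C 0<1
      -- δ = ε / (B + (C + 1)): `dist-*` needs a bound on one factor of each product, here `L` by B
      -- and, once t n is within 1 of `M`, t n by C + 1.
      δ , 0<δ , eq = quotient (+-pos 0<B 0<C+1) 0<ε
  in both
    (λ n → both λ k sL (tM<1 , tM) →
      let a = seq (s n) k ; b = seq (t n) k ; c = seq L k ; d = seq M k
          b≤C+1 : ℚ.∣ b ∣ ℚ.≤ C ℚ.+ 1ℚ
          b≤C+1 = ℚ.≤-trans
            (subst (ℚ._≤ ℚ.∣ d ∣ ℚ.+ ℚ.∣ b ℚ.- d ∣)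
              (cong ℚ.∣_∣ (solve 2 (λ d b → d :+ (b :- d) := b) ≡.refl d b))
              (ℚ.∣p+q∣≤∣p∣+∣q∣ d (b ℚ.- d)))
            (ℚ.+-mono-≤ (M≤C k) (ℚ.<⇒≤ tM<1))
      in ≡.subst₂ ℚ._<_ (dist-sym (c ℚ.* d) (a ℚ.* b)) eq
           (dist-* c d a b 0<B 0<C+1 (L≤B k) b≤C+1
             (subst (ℚ._< δ) (dist-sym a c) sL) (subst (ℚ._< δ) (dist-sym b d) tM)))
    (close s⇝L δ 0<δ)
    (both (λ n → both λ k tM<1 tM → tM<1 , tM) (close t⇝M 1ℚ 0<1) (close t⇝M δ 0<δ))

⇝-∑ : ∀ {m} {s : ℕ → Vector ℝ m} {L : Vector ℝ m} →
  (∀ i → (λ n → s n i) ⇝ L i) → (λ n → ∑[ i < m ] s n i) ⇝ (∑[ i < m ] L i)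
⇝-∑ {zero}  s⇝L = ⇝-const
⇝-∑ {suc m} s⇝L = ⇝-+ (s⇝L Fin.zero) (⇝-∑ (s⇝L ∘ Fin.suc))

⇝-suc⁻ : ∀ {s L} → (s ∘ suc) ⇝ L → s ⇝ L
⇝-suc⁻ s⇝L = mk⇝ λ ε 0<ε → let N , c = close s⇝L ε 0<ε in
  suc N , λ { (suc n) (ℕ.s≤s N≤n) → c n N≤n }

⇝-suc : ∀ {s L} → s ⇝ L → (s ∘ suc) ⇝ L
⇝-suc s⇝L = mk⇝ λ ε 0<ε → let N , c = close s⇝L ε 0<ε in
  N , λ n N≤n → c (suc n) (ℕ.m≤n⇒m≤1+n N≤n)

-- The exponential function

partialSum : (ℕ → ℝ) → ℕ → ℝ
partialSum f N = ∑[ n < N ] f (toℕ n)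

exp-⇝ : ∀ x → partialSum (expTerm x) ⇝ exp x
exp-⇝ x = ⟶⇒⇝ (proj₂ (exp-series x))

-- Operations on reals act on each approximation separately, so that estimates for rational series
-- that hold for all k transfer to real ones.
seq-expTerm : ∀ x n k → seq (expTerm x n) k ≡ expTermℚ (seq x k) n
seq-expTerm x zero    k = ≡.refl
seq-expTerm x (suc n) k = ≡.trans
  (≡.trans
    (cong (seq x k ℚ.* seq (x ^ n) k ℚ.*_) (1/suc! n k))
    (solve 4 (λ a b c d → (a :* b) :* (c :* d) := (a :* (b :* c)) :* d) ≡.refl
      (seq x k) (seq (x ^ n) k) (seq (1/ n !) k) (1/1+ n)))
  (cong (λ t → (seq x k ℚ.* t) ℚ.* (1/1+ n)) (seq-expTerm x n k))

seq-expSum : ∀ x N k → seq (partialSum (expTerm x) N) k ≡ psum (expTermℚ (seq x k)) N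
seq-expSum x zero    k = ≡.refl
seq-expSum x (suc N) k = ≡.trans (sum-last N (expTerm x) k)
  (cong₂ ℚ._+_ (seq-expSum x N k) (seq-expTerm x N k))

-- Both partial sums lie within ε / 2 of the one at `N`.
expSum-tail : ∀ q ε → 0ℚ ℚ.< ε → Eventually λ n →
  psum (expTermℚ q) (n ℕ.+ n) ℚ.- psum (expTermℚ q) n ℚ.< ε
expSum-tail q ε 0<ε =
  let N , u = ExpConvergence.uniform (fromℚ q) _ (½ε>0 0<ε)
      P = psum (expTermℚ q)
      v : ∀ n → N ℕ.≤ n → ℚ.∣ P n ℚ.- P N ∣ ℚ.< ½ ℚ.* ε
      -- All approximations of a constant real coincide, so looking at index 0 is enough.
      v n N≤n = ≡.subst₂ (λ a b → ℚ.∣ a ℚ.- b ∣ ℚ.< ½ ℚ.* ε)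
        (seq-expSum (fromℚ q) n 0) (seq-expSum (fromℚ q) N 0) (u n N≤n 0)
  in N , λ n N≤n → ℚ.≤-<-trans (p≤∣p∣ (P (n ℕ.+ n) ℚ.- P n))
       (halves-< ε (dist-triangle (P (n ℕ.+ n)) (P N) (P n))
         (v (n ℕ.+ n) (ℕ.≤-trans N≤n (ℕ.m≤m+n n n)))
         (subst (ℚ._< ½ ℚ.* ε) (dist-sym (P n) (P N)) (v n N≤n)))
  where
  p≤∣p∣ : ∀ p → p ℚ.≤ ℚ.∣ p ∣
  p≤∣p∣ p with ℚ.≤-total 0ℚ p
  ... | inj₁ 0≤p = ℚ.≤-reflexive (≡.sym (ℚ.0≤p⇒∣p∣≡p 0≤p))
  ... | inj₂ p≤0 = ℚ.≤-trans p≤0 (ℚ.0≤∣p∣ p)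

-- The products of partial sums converge to exp x * exp y and, being uniformly close to the partial
-- sums for x + y, also to exp (x + y); limits are unique.
exp-+ : ∀ x y → exp x * exp y ≃ exp (x + y)
exp-+ x y = ⇝-unique (⇝-* (exp-⇝ x) (exp-⇝ y)) (⇝-uniformly-close near (exp-⇝ (x + y)))
  where
  -- The sum of the two bounds, both positive, bounds x and y at once.
  B = proj₁ (bounded x) ℚ.+ proj₁ (bounded y)
  0<Bˣ = proj₁ (proj₂ (bounded x))
  0<Bʸ = proj₁ (proj₂ (bounded y))

  x≤B : ∀ k → ℚ.∣ seq x k ∣ ℚ.≤ B
  x≤B k = subst (ℚ._≤ B) (ℚ.+-identityʳ ℚ.∣ seq x k ∣)
    (ℚ.+-mono-≤ (proj₂ (proj₂ (bounded x)) k) (ℚ.<⇒≤ 0<Bʸ))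

  y≤B : ∀ k → ℚ.∣ seq y k ∣ ℚ.≤ B
  y≤B k = subst (ℚ._≤ B) (ℚ.+-identityˡ ℚ.∣ seq y k ∣)
    (ℚ.+-mono-≤ (ℚ.<⇒≤ 0<Bˣ) (proj₂ (proj₂ (bounded y)) k))

  near : ∀ ε → 0ℚ ℚ.< ε → Eventually λ n → ∀ k →
    ℚ.∣ seq (partialSum (expTerm x) n * partialSum (expTerm y) n) k
      ℚ.- seq (partialSum (expTerm (x + y)) n) k ∣ ℚ.< ε
  -- The threshold depends only on B and ε, hence is the same for all k.
  near ε 0<ε = let N , tail = expSum-tail (B ℚ.+ B) ε 0<ε in
    N , λ n N≤n k → ℚ.≤-<-trans
      (subst (ℚ._≤ _)
        (≡.sym (cong₂ (λ a b → ℚ.∣ a ℚ.- b ∣)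
          (cong₂ ℚ._*_ (seq-expSum x n k) (seq-expSum y n k)) (seq-expSum (x + y) n k)))
        (expSum-*-dist (ℚ.<⇒≤ (+-pos 0<Bˣ 0<Bʸ)) (x≤B k) (y≤B k) n))
      (tail n N≤n)

-- All partial sums but the empty one equal 1, whence the shift by `⇝-suc⁻`. The argument is only
-- assumed equivalent to 0# because it will be - x + x.
exp-zero : ∀ {x} → x ≃ 0# → exp x ≃ 1#
exp-zero {x} x≃0 = ⇝-unique (exp-⇝ x) (⇝-suc⁻ (⇝-cong ones ⇝-const))
  where
  open ≃-Reasoning
  term : ∀ n → expTerm x (suc n) ≃ 0#
  term n = ≃-trans (*-congʳ (≃-trans (*-congʳ x≃0) (zeroˡ (x ^ n)))) (zeroˡ (1/ suc n !))
  ones : ∀ n → 1# ≃ partialSum (expTerm x) (suc n)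
  ones n = ≃-sym (begin
    1# * 1/ 0 ! + ∑[ i < n ] expTerm x (suc (toℕ i))
      ≈⟨ +-cong (*-identityˡ (1/ 0 !)) (Sum.sum-cong-≋ {n} (λ i → term (toℕ i))) ⟩
    1/ 0 ! + ∑[ i < n ] 0#
      ≈⟨ +-cong (pointwise-≃ (λ _ → ≡.refl)) (Sum.sum-replicate-zero n) ⟩
    1# + 0#
      ≈⟨ +-identityʳ 1# ⟩
    1# ∎)

exp-inverseˡ : ∀ x → exp (- x) * exp x ≃ 1#
exp-inverseˡ x = ≃-trans (exp-+ (- x) x) (exp-zero (-‿inverseˡ x))

-- Falling factorials and differential operators

fromℕ-suc : ∀ n → fromℕ (suc n) ≃ fromℕ n + 1#
fromℕ-suc n = pointwise-≃ λ _ → natℚ-suc n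

fromℕ-*-1/! : ∀ n → fromℕ (suc n) * 1/ suc n ! ≃ 1/ n !
fromℕ-*-1/! n = pointwise-≃ λ k →
  let ν = natℚ (suc n) ; a = seq (1/ n !) k ; r = 1/1+ n in
  ≡.trans (cong (ν ℚ.*_) (1/suc! n k)) (≡.trans
    (solve 3 (λ ν a r → ν :* (a :* r) := a :* (ν :* r)) ≡.refl ν a r)
    (≡.trans (cong (a ℚ.*_) (natℚ*1/1+n≡1 n)) (ℚ.*-identityʳ a)))

falling-cong : ∀ {x y} m → x ≃ y → falling x m ≃ falling y m
falling-cong zero    x≃y = ≃-refl
falling-cong (suc m) x≃y = *-cong (falling-cong m x≃y) (+-congʳ x≃y)

falling-0 : ∀ m → falling (fromℕ 0) (suc m) ≃ 0#
falling-0 zero    = pointwise-≃ λ _ → ≡.refl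
falling-0 (suc m) = ≃-trans (*-congʳ (falling-0 m)) (zeroˡ (fromℕ 0 - fromℕ (suc m)))

-- `falling` appends its last factor; this extracts the first one, x + 1, and the factors x, x - 1,
-- ... that remain make up (x)ₘ.
falling-head : ∀ x m → falling (x + 1#) (suc m) ≃ (x + 1#) * falling x m
falling-head x zero    = pointwise-≃ λ k →
  solve 1 (λ x → con 1ℚ :* ((x :+ con 1ℚ) :- con 0ℚ) := (x :+ con 1ℚ) :* con 1ℚ) ≡.refl (seq x k)
falling-head x (suc m) = begin
  falling (x + 1#) (suc m) * (x + 1# - fromℕ (suc m))
    ≈⟨ *-cong (falling-head x m) (+-congˡ (-‿cong (fromℕ-suc m))) ⟩
  (x + 1#) * falling x m * (x + 1# - (fromℕ m + 1#))
    ≈⟨ pointwise-≃ (λ k → solve 3 (λ x f m →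
         ((x :+ con 1ℚ) :* f) :* ((x :+ con 1ℚ) :- (m :+ con 1ℚ))
           := (x :+ con 1ℚ) :* (f :* (x :- m))) ≡.refl
         (seq x k) (seq (falling x m) k) (natℚ m)) ⟩
  (x + 1#) * (falling x m * (x - fromℕ m)) ∎
  where open ≃-Reasoning

falling-suc : ∀ n m → falling (fromℕ (suc n)) (suc m) ≃ fromℕ (suc n) * falling (fromℕ n) m
falling-suc n m = begin
  falling (fromℕ (suc n)) (suc m)       ≈⟨ falling-cong (suc m) (fromℕ-suc n) ⟩
  falling (fromℕ n + 1#) (suc m)        ≈⟨ falling-head (fromℕ n) m ⟩
  (fromℕ n + 1#) * falling (fromℕ n) m  ≈⟨ *-congʳ (fromℕ-suc n) ⟨
  fromℕ (suc n) * falling (fromℕ n) m   ∎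
  where open ≃-Reasoning

degenerateFalling-cong : ∀ lam {x y} k → x ≃ y →
  degenerateFalling lam x k ≃ degenerateFalling lam y k
degenerateFalling-cong lam zero    x≃y = ≃-refl
degenerateFalling-cong lam (suc k) x≃y = *-cong (degenerateFalling-cong lam k x≃y) (+-congʳ x≃y)

degenerateFalling-0 : ∀ lam k → degenerateFalling lam 0# (suc k) ≃ 0#
degenerateFalling-0 lam zero    = pointwise-≃ λ k →
  solve 1 (λ l → con 1ℚ :* (con 0ℚ :- con 0ℚ :* l) := con 0ℚ) ≡.refl (seq lam k)
degenerateFalling-0 lam (suc k) =
  ≃-trans (*-congʳ (degenerateFalling-0 lam k)) (zeroˡ (0# - fromℕ (suc k) * lam))

-- Action of the operators on coefficients

coeff-+ : ∀ p q n → coeff (p +ₚ q) n ≃ coeff p n + coeff q n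
coeff-+ []      q       n       = ≃-sym (+-identityˡ (coeff q n))
coeff-+ (a ∷ p) []      n       = ≃-sym (+-identityʳ (coeff (a ∷ p) n))
coeff-+ (a ∷ p) (b ∷ q) zero    = ≃-refl
coeff-+ (a ∷ p) (b ∷ q) (suc n) = coeff-+ p q n

coeff-· : ∀ a p n → coeff (a ·ₚ p) n ≃ a * coeff p n
coeff-· a []      n       = ≃-sym (zeroʳ a)
coeff-· a (b ∷ p) zero    = ≃-refl
coeff-· a (b ∷ p) (suc n) = coeff-· a p n

coeff-∑ : ∀ {m} (ps : Vector Poly m) n → coeff (foldr _+ₚ_ [] ps) n ≃ ∑[ i < m ] coeff (ps i) n
coeff-∑ {zero}  ps n = ≃-refl
coeff-∑ {suc m} ps n = ≃-trans (coeff-+ (ps Fin.zero) _ n) (+-congˡ (coeff-∑ (ps ∘ Fin.suc) n))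

-- In (a + x p)′ = p + x p′ the coefficient of index n + 1 of p appears once from p and, by
-- induction, n + 1 times from x p′.
coeff-D : ∀ p n → coeff (D p) n ≃ fromℕ (suc n) * coeff p (suc n)
coeff-D []      n       = ≃-sym (zeroʳ (fromℕ (suc n)))
coeff-D (a ∷ p) zero    = begin
  coeff (p +ₚ X (D p)) 0  ≈⟨ coeff-+ p (X (D p)) 0 ⟩
  coeff p 0 + 0#          ≈⟨ +-identityʳ (coeff p 0) ⟩
  coeff p 0               ≈⟨ *-identityˡ (coeff p 0) ⟨
  1# * coeff p 0          ≈⟨ *-congʳ (pointwise-≃ (λ _ → ≡.refl)) ⟩
  fromℕ 1 * coeff p 0     ∎
  where open ≃-Reasoning
coeff-D (a ∷ p) (suc n) = begin
  coeff (p +ₚ X (D p)) (suc n)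
    ≈⟨ coeff-+ p (X (D p)) (suc n) ⟩
  coeff p (suc n) + coeff (D p) n
    ≈⟨ +-congˡ (coeff-D p n) ⟩
  coeff p (suc n) + fromℕ (suc n) * coeff p (suc n)
    ≈⟨ pointwise-≃ (λ k → solve 2 (λ ν c → c :+ ν :* c := (ν :+ con 1ℚ) :* c) ≡.refl
         (natℚ (suc n)) (seq (coeff p (suc n)) k)) ⟩
  (fromℕ (suc n) + 1#) * coeff p (suc n)
    ≈⟨ *-congʳ (fromℕ-suc (suc n)) ⟨
  fromℕ (suc (suc n)) * coeff p (suc n) ∎
  where open ≃-Reasoning

-- Iteration puts the new `D` outermost; the induction in `coeff-xD` needs it innermost.
D^-suc : ∀ j p → (D ^ᵒ suc j) p ≡ (D ^ᵒ j) (D p)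
D^-suc zero    p = ≡.refl
D^-suc (suc j) p = cong D (D^-suc j p)

-- The outer `X` lowers the index from n + 1 to n, the inner `D` contributes n + 1, and (n + 1) (n)ⱼ
-- = (n + 1)ⱼ₊₁. For this `p` has to vary in the induction on j.
coeff-xD : ∀ j p n → coeff (xD j p) n ≃ falling (fromℕ n) j * coeff p n
coeff-xD zero    p n       = ≃-sym (*-identityˡ (coeff p n))
-- The outer `X` leaves constant coefficient 0, in agreement with (0)ⱼ₊₁ = 0.
coeff-xD (suc j) p zero    = ≃-sym (≃-trans (*-congʳ (falling-0 j)) (zeroˡ (coeff p 0)))
coeff-xD (suc j) p (suc n) = begin
  coeff ((X ^ᵒ j) ((D ^ᵒ suc j) p)) n
    ≡⟨ cong (λ q → coeff ((X ^ᵒ j) q) n) (D^-suc j p) ⟩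
  coeff (xD j (D p)) n
    ≈⟨ coeff-xD j (D p) n ⟩
  falling (fromℕ n) j * coeff (D p) n
    ≈⟨ *-congˡ (coeff-D p n) ⟩
  falling (fromℕ n) j * (fromℕ (suc n) * coeff p (suc n))
    ≈⟨ *-assoc (falling (fromℕ n) j) (fromℕ (suc n)) (coeff p (suc n)) ⟨
  falling (fromℕ n) j * fromℕ (suc n) * coeff p (suc n)
    ≈⟨ *-congʳ (*-comm (falling (fromℕ n) j) (fromℕ (suc n))) ⟩
  fromℕ (suc n) * falling (fromℕ n) j * coeff p (suc n)
    ≈⟨ *-congʳ (falling-suc n j) ⟨
  falling (fromℕ (suc n)) (suc j) * coeff p (suc n) ∎
  where open ≃-Reasoning

-- Each factor xʳDʳ - iλ multiplies the n-th coefficient by (n)ᵣ - iλ, so the product collects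
-- ((n)ᵣ)ₖ,λ.
coeff-degeneratePower : ∀ lam r k p n →
  coeff (degeneratePower lam r k p) n ≃ degenerateFalling lam (falling (fromℕ n) r) k * coeff p n
coeff-degeneratePower lam r zero    p n = ≃-sym (*-identityˡ (coeff p n))
coeff-degeneratePower lam r (suc k) p n = begin
  coeff (xD r q +ₚ (- (fromℕ k * lam)) ·ₚ q) n
    ≈⟨ coeff-+ (xD r q) ((- (fromℕ k * lam)) ·ₚ q) n ⟩
  coeff (xD r q) n + coeff ((- (fromℕ k * lam)) ·ₚ q) n
    ≈⟨ +-cong (coeff-xD r q n) (coeff-· (- (fromℕ k * lam)) q n) ⟩
  y * coeff q n + (- (fromℕ k * lam)) * coeff q n
    ≈⟨ distribʳ (coeff q n) y (- (fromℕ k * lam)) ⟨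
  (y - fromℕ k * lam) * coeff q n
    ≈⟨ *-congˡ (coeff-degeneratePower lam r k p n) ⟩
  (y - fromℕ k * lam) * (degenerateFalling lam y k * coeff p n)
    ≈⟨ *-assoc (y - fromℕ k * lam) (degenerateFalling lam y k) (coeff p n) ⟨
  (y - fromℕ k * lam) * degenerateFalling lam y k * coeff p n
    ≈⟨ *-congʳ (*-comm (y - fromℕ k * lam) (degenerateFalling lam y k)) ⟩
  degenerateFalling lam y k * (y - fromℕ k * lam) * coeff p n ∎
  where
  open ≃-Reasoning
  q = degeneratePower lam r k p
  y = falling (fromℕ n) r

coeff-monomial : ∀ n → coeff ((X ^ᵒ n) (1# ∷ [])) n ≡ 1#
coeff-monomial zero    = ≡.refl
coeff-monomial (suc n) = coeff-monomial n

-- The operator identity is tested on the monomial xⁿ, and the coefficients of xⁿ on both sides are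
-- compared.
normalOrdering-eigenvalues : ∀ lam r k S → IsNormalOrdering lam r k S → ∀ n →
  degenerateFalling lam (falling (fromℕ n) r) k ≃ ∑[ j ≤ k ℕ.* r ] (S j * falling (fromℕ n) (toℕ j))
normalOrdering-eigenvalues lam r k S ordering n = begin
  a
    ≈⟨ *-identityʳ a ⟨
  a * 1#
    ≡⟨ cong (a *_) (coeff-monomial n) ⟨
  a * coeff p n
    ≈⟨ coeff-degeneratePower lam r k p n ⟨
  coeff (degeneratePower lam r k p) n
    ≈⟨ ≈⇒≃ (ordering p n) ⟩
  coeff (foldr _+ₚ_ [] (λ j → S j ·ₚ xD (toℕ j) p)) n
    ≈⟨ coeff-∑ (λ j → S j ·ₚ xD (toℕ j) p) n ⟩
  ∑[ j ≤ k ℕ.* r ] coeff (S j ·ₚ xD (toℕ j) p) n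
    ≈⟨ Sum.sum-cong-≋ (λ j → ≃-trans (coeff-· (S j) (xD (toℕ j) p) n) (*-congˡ (term (toℕ j)))) ⟩
  ∑[ j ≤ k ℕ.* r ] (S j * falling (fromℕ n) (toℕ j)) ∎
  where
  open ≃-Reasoning
  p = (X ^ᵒ n) (1# ∷ [])
  a = degenerateFalling lam (falling (fromℕ n) r) k
  term : ∀ j → coeff (xD j p) n ≃ falling (fromℕ n) j
  term j = begin
    coeff (xD j p) n                   ≈⟨ coeff-xD j p n ⟩
    falling (fromℕ n) j * coeff p n    ≡⟨ cong (falling (fromℕ n) j *_) (coeff-monomial n) ⟩
    falling (fromℕ n) j * 1#           ≈⟨ *-identityʳ (falling (fromℕ n) j) ⟩
    falling (fromℕ n) j                ∎

-- Dobinski's formula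

partialSum-*ˡ : ∀ x f N → x * partialSum f N ≃ partialSum (λ n → x * f n) N
partialSum-*ˡ x f N = Sum.*-distribˡ-sum {N} x (f ∘ toℕ)

partialSum-cong : ∀ {f g} → (∀ n → f n ≃ g n) → ∀ N → partialSum f N ≃ partialSum g N
partialSum-cong f≃g N = Sum.sum-cong-≋ {N} (f≃g ∘ toℕ)

partialSum-tail : ∀ {f L} → f 0 ≃ 0# → partialSum f ⇝ L → partialSum (f ∘ suc) ⇝ L
partialSum-tail {f} f₀≃0 f⇝L = ⇝-cong
  (λ N → ≃-trans (+-congʳ f₀≃0) (+-identityˡ (partialSum (f ∘ suc) N))) (⇝-suc f⇝L)

partialSum-tail⁻ : ∀ {f L} → f 0 ≃ 0# → partialSum (f ∘ suc) ⇝ L → partialSum f ⇝ L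
partialSum-tail⁻ {f} f₀≃0 f⇝L = ⇝-suc⁻ (⇝-cong
  (λ N → ≃-sym (≃-trans (+-congʳ f₀≃0) (+-identityˡ (partialSum (f ∘ suc) N)))) f⇝L)

-- For x > 0 and up to the factor e⁻ˣ, these are the factorial moments of the Poisson distribution.
-- Since (n + 1)ⱼ₊₁ / (n + 1)! = (n)ⱼ / n!, the term of index n + 1 for j + 1 is x times the term of
-- index n for j.
falling-moment : ∀ x j → partialSum (λ n → expTerm x n * falling (fromℕ n) j) ⇝ (x ^ j * exp x)
falling-moment x zero = ⇝-congʳ (≃-sym (*-identityˡ (exp x)))
  (⇝-cong (partialSum-cong (λ n → ≃-sym (*-identityʳ (expTerm x n)))) (exp-⇝ x))
falling-moment x (suc j) = ⇝-congʳ (≃-sym (*-assoc x (x ^ j) (exp x)))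
  -- The term at n = 0 contains (0)ⱼ₊₁ = 0, so the series may start at n = 1.
  (partialSum-tail⁻ {λ n → expTerm x n * falling (fromℕ n) (suc j)}
    (≃-trans (*-congˡ (falling-0 j)) (zeroʳ (expTerm x 0)))
    (⇝-cong
      (λ N → ≃-trans
        (partialSum-*ˡ x (λ n → expTerm x n * falling (fromℕ n) j) N) (partialSum-cong step N))
      (⇝-* ⇝-const (falling-moment x j))))
  where
  step : ∀ n → x * (expTerm x n * falling (fromℕ n) j) ≃
               expTerm x (suc n) * falling (fromℕ (suc n)) (suc j)
  step n = ≃-sym (begin
    x * x ^ n * 1/ suc n ! * falling (fromℕ (suc n)) (suc j)
      ≈⟨ *-congˡ (falling-suc n j) ⟩
    x * x ^ n * 1/ suc n ! * (fromℕ (suc n) * f)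
      ≈⟨ pointwise-≃ (λ k → solve 5 (λ x p a ν f →
           ((x :* p) :* a) :* (ν :* f) := x :* ((p :* (ν :* a)) :* f)) ≡.refl
           (seq x k) (seq (x ^ n) k) (seq (1/ suc n !) k) (natℚ (suc n)) (seq f k)) ⟩
    x * (x ^ n * (fromℕ (suc n) * 1/ suc n !) * f)
      ≈⟨ *-congˡ (*-congʳ (*-congˡ (fromℕ-*-1/! n))) ⟩
    x * (x ^ n * 1/ n ! * f) ∎)
    where
    open ≃-Reasoning
    f = falling (fromℕ n) j

*-swap : ∀ x y z → x * (y * z) ≃ y * (x * z)
*-swap x y z = pointwise-≃ λ k →
  solve 3 (λ x y z → x :* (y :* z) := y :* (x :* z)) ≡.refl (seq x k) (seq y k) (seq z k)

module _ (lam : ℝ) (r k : ℕ) (S : Vector ℝ (suc (k ℕ.* r))) (ordering : IsNormalOrdering lam r k S)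
  where

  private
    a : ℕ → ℝ
    a n = degenerateFalling lam (falling (fromℕ n) r) k

  -- The series is a finite combination, with coefficients S j, of the series in `falling-moment`,
  -- so limit and sum over j interchange.
  dobinski : ∀ x → partialSum (λ n → expTerm x n * a n) ⇝ (φ S x * exp x)
  dobinski x = ⇝-congʳ limit (⇝-cong sums
    (⇝-∑ (λ j → ⇝-* (⇝-const {S j}) (falling-moment x (toℕ j)))))
    where
    open ≃-Reasoning
    g : ℕ → ℕ → ℝ
    g j n = expTerm x n * falling (fromℕ n) j

    limit : ∑[ j ≤ k ℕ.* r ] (S j * (x ^ toℕ j * exp x)) ≃ φ S x * exp x
    limit = begin
      ∑[ j ≤ k ℕ.* r ] (S j * (x ^ toℕ j * exp x))
        ≈⟨ Sum.sum-cong-≋ (λ j → *-assoc (S j) (x ^ toℕ j) (exp x)) ⟨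
      ∑[ j ≤ k ℕ.* r ] (S j * x ^ toℕ j * exp x)
        ≈⟨ Sum.*-distribʳ-sum (exp x) (λ j → S j * x ^ toℕ j) ⟨
      φ S x * exp x ∎

    terms : ∀ n → ∑[ j ≤ k ℕ.* r ] (S j * g (toℕ j) n) ≃ expTerm x n * a n
    terms n = begin
      ∑[ j ≤ k ℕ.* r ] (S j * (expTerm x n * falling (fromℕ n) (toℕ j)))
        ≈⟨ Sum.sum-cong-≋ (λ j → *-swap (S j) (expTerm x n) (falling (fromℕ n) (toℕ j))) ⟩
      ∑[ j ≤ k ℕ.* r ] (expTerm x n * (S j * falling (fromℕ n) (toℕ j)))
        ≈⟨ Sum.*-distribˡ-sum (expTerm x n) (λ j → S j * falling (fromℕ n) (toℕ j)) ⟨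
      expTerm x n * ∑[ j ≤ k ℕ.* r ] (S j * falling (fromℕ n) (toℕ j))
        ≈⟨ *-congˡ (normalOrdering-eigenvalues lam r k S ordering n) ⟨
      expTerm x n * a n ∎

    sums : ∀ N → ∑[ j ≤ k ℕ.* r ] (S j * partialSum (g (toℕ j)) N) ≃
                 partialSum (λ n → expTerm x n * a n) N
    sums N = begin
      ∑[ j ≤ k ℕ.* r ] (S j * partialSum (g (toℕ j)) N)
        ≈⟨ Sum.sum-cong-≋ (λ j → partialSum-*ˡ (S j) (g (toℕ j)) N) ⟩
      ∑[ j ≤ k ℕ.* r ] ∑[ n < N ] (S j * g (toℕ j) (toℕ n))
        ≈⟨ Sum.∑-comm {suc (k ℕ.* r)} {N} (λ j n → S j * g (toℕ j) (toℕ n)) ⟩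
      ∑[ n < N ] ∑[ j ≤ k ℕ.* r ] (S j * g (toℕ j) (toℕ n))
        ≈⟨ partialSum-cong terms N ⟩
      partialSum (λ n → expTerm x n * a n) N ∎

cancelˡ : ∀ {x y} z → x * y ≃ 1# → z ≃ x * (z * y)
cancelˡ {x} {y} z xy≃1 = begin
  z            ≈⟨ *-identityʳ z ⟨
  z * 1#       ≈⟨ *-congˡ xy≃1 ⟨
  z * (x * y)  ≈⟨ *-swap z x y ⟩
  x * (z * y)  ∎
  where open ≃-Reasoning

1^n≃1 : ∀ n → 1# ^ n ≃ 1#
1^n≃1 zero    = ≃-refl
1^n≃1 (suc n) = ≃-trans (*-identityˡ (1# ^ n)) (1^n≃1 n)

expTerm-1 : ∀ n → expTerm 1# n ≃ 1/ n !
expTerm-1 n = ≃-trans (*-congʳ (1^n≃1 n)) (*-identityˡ (1/ n !))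

theorem10 : (lam : ℝ) (r k : ℕ) → 1 ℕ.≤ r → 1 ℕ.≤ k →
    (S : Vector ℝ (suc (k ℕ.* r))) → IsNormalOrdering lam r k S →
    ((z : ℂ) → ∃ λ σ →
    HasSum₁ (λ n → ∣ z ∣² ^ n * 1/ n ! * degenerateFalling lam (falling (fromℕ n) r) k) σ
    × φ S ∣ z ∣² ≈ exp (- ∣ z ∣²) * σ)
    ×
    (∃ λ σ →
    HasSum₁ (λ n → 1/ n ! * degenerateFalling lam (falling (fromℕ n) r) k) σ
    × φ S 1# ≈ e ⁻¹⟨ 0<e ⟩ * σ)
theorem10 lam (suc r) (suc k) _ _ S ordering =
  (λ z → let y = ∣ z ∣² in
    -- The sum σ is φ(y) eʸ, and e⁻ʸ eʸ = 1 removes the exponential.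
    φ S y * exp y , ⇝⇒⟶ (tail y) , ≃⇒≈ (cancelˡ (φ S y) (exp-inverseˡ y))) ,
  (φ S 1# * e ,
   -- At x = 1 the powers 1ⁿ are dropped from the terms.
   ⇝⇒⟶ (⇝-cong (partialSum-cong (λ n → *-congʳ {a (suc n)} (expTerm-1 (suc n)))) (tail 1#)) ,
   ≃⇒≈ (cancelˡ (φ S 1#) (≃-trans (*-comm (e ⁻¹⟨ 0<e ⟩) e) (≈⇒≃ (proj₂ (reciprocal e 0<e))))))
  where
  a : ℕ → ℝ
  a n = degenerateFalling lam (falling (fromℕ n) (suc r)) (suc k)
  -- (0)ᵣ = 0 as r ≥ 1, and then the first factor of (0)ₖ,λ vanishes as k ≥ 1; the series from n = 0
  -- and from n = 1 therefore agree.
  a₀≃0 : a 0 ≃ 0#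
  a₀≃0 = ≃-trans (degenerateFalling-cong lam (suc k) (falling-0 r)) (degenerateFalling-0 lam k)
  tail : ∀ x → partialSum (λ n → expTerm x (suc n) * a (suc n)) ⇝ (φ S x * exp x)
  tail x = partialSum-tail {λ n → expTerm x n * a n}
    (≃-trans (*-congˡ a₀≃0) (zeroʳ (expTerm x 0))) (dobinski lam (suc r) (suc k) S ordering x)
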